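{- Under a graph isomorphism $C_4\times C_4\xrightarrow{\sim}Q_4$, the $384$ most-perfect $4\times4$ magic squares form the single orbit of the Khajuraho Magic Square under the faithful action of the group $\mathrm{Aut}_{\mathrm{graph}}(C_4\times C_4)=\mathrm{Aut}(Q_4)\cong W(B_4)=C_2^4\rtimes S_4$, of order $16\times24=384$.
   Context: A most-perfect $4\times4$ magic square is an arrangement of the numbers $1,\ldots,16$ in a $4\times4$ square such that every row, column, $2\times2$ subsquare (including those that wrap around, i.e. positions $\{i,i+1\}\times\{j,j+1\}$ modulo $4$), and every diagonal and pandiagonal (wrap-around, or broken, diagonal) sums to the same magic constant ($34$). The Khajuraho Magic Square is the $4\times 4$ square with rows, from top to bottom, $$(7,12,1,14),\quad(2,13,8,11),\quad(16,3,10,5),\quad(9,6,15,4).$$ $C_4\times C_4$ is the Cartesian product of two $4$-cycles, i.e. the toroidal $4\times4$ grid graph, whose vertices are the positions of the square; $Q_4$ is the hypercube graph on $\{0,1\}^4$. Graph automorphisms of $C_4\times C_4$ act on arrangements of $1,\ldots,16$ by permuting positions. $W(B_4)$ is the hyperoctahedral group of order $384$. -}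

module Defs where

open import Level using (0ℓ)
open import Algebra.Bundles using (Group)
open import Algebra.Morphism.Structures using (module GroupMorphisms)
import Algebra.Construct.Pointwise as Pointwise
open import Algebra.Properties.Monoid.Sum using (sum)
open import Data.Bool.Base using (Bool)
open import Data.Fin.Base using (Fin; toℕ; opposite)
open import Data.Fin.Patterns using (0F; 1F; 2F; 3F)
import Data.Fin.Properties as Fin
open import Data.Nat.Base using (ℕ; _+_; _≤_; s≤s; NonZero)
open import Data.Nat.DivMod using (_mod_)
import Data.Nat.Properties as ℕ
open import Data.Product.Base using (Σ; ∃; ∃-syntax; _×_; _,_; proj₁; proj₂; map₁)
open import Data.Product.Properties using (≡-dec)
import Data.Sign.Base as Sign
open Sign using (Sign)
import Data.Sign.Properties as Sign
open import Data.Sum.Base using (_⊎_; inj₁; inj₂; swap)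
open import Data.Vec.Base using (Vec; []; _∷_; lookup)
open import Data.Vec.Functional using (Vector)
open import Function.Base using (_∘_)
open import Function.Bundles using (_↔_; _⇔_; mk⇔; Inverse)
open import Function.Construct.Composition using (_↔-∘_; _⇔-∘_)
open import Function.Construct.Identity using (↔-id; ⇔-id)
open import Function.Construct.Symmetry using (↔-sym; ⇔-sym)
open import Relation.Binary.Bundles using (Setoid)
open import Relation.Binary.Core using (Rel)
open import Relation.Binary.Definitions using (Symmetric)
import Relation.Binary.Construct.On as On
open import Relation.Binary.PropositionalEquality
  using (_≡_; _≢_; refl; sym; trans; cong; subst₂; setoid)
open import Relation.Nullary.Decidable using (toWitness; _×-dec_; _→-dec_)
open import Relation.Nullary.Negation using (¬_)
open import Relation.Unary using (Pred)

open Inverse using (to; from; strictlyInverseˡ; strictlyInverseʳ)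

Grp : Set₁
Grp = Group 0ℓ 0ℓ

HasCardinality : Setoid 0ℓ 0ℓ → ℕ → Set
HasCardinality X n = Inverse (setoid (Fin n)) X

Order : Grp → ℕ → Set
Order G n = HasCardinality (Group.setoid G) n

IsGroupIsomorphism : (G H : Grp) → (Group.Carrier G → Group.Carrier H) → Set
IsGroupIsomorphism G H =
  GroupMorphisms.IsGroupIsomorphism (Group.rawGroup G) (Group.rawGroup H)

infix 4 _≅_
_≅_ : Grp → Grp → Set
G ≅ H = ∃ (IsGroupIsomorphism G H)

module _ (G : Grp) where
  open Group G

  subgroup : (P : Pred Carrier 0ℓ) →
             (∀ {x y} → P x → P y → P (x ∙ y)) → P ε → (∀ {x} → P x → P (x ⁻¹)) →
             Grp
  subgroup P ∙-closed ε-closed ⁻¹-closed = record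
    { Carrier = Σ Carrier P
    ; _≈_     = λ x y → proj₁ x ≈ proj₁ y
    ; _∙_     = λ (x , p) (y , q) → x ∙ y , ∙-closed p q
    ; ε       = ε , ε-closed
    ; _⁻¹     = λ (x , p) → x ⁻¹ , ⁻¹-closed p
    ; isGroup = record
      { isMonoid = record
        { isSemigroup = record
          { isMagma = record
            { isEquivalence = On.isEquivalence proj₁ isEquivalence
            ; ∙-cong        = ∙-cong
            }
          ; assoc = λ x y z → assoc (proj₁ x) (proj₁ y) (proj₁ z)
          }
        ; identity = (λ x → identityˡ (proj₁ x)) , (λ x → identityʳ (proj₁ x))
        }
      ; inverse = (λ x → inverseˡ (proj₁ x)) , (λ x → inverseʳ (proj₁ x))
      ; ⁻¹-cong = ⁻¹-cong
      }
    }

record Action (G : Grp) (X : Setoid 0ℓ 0ℓ) : Set where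
  private
    module G = Group G
    module X = Setoid X
  infixr 5 _▷_
  field
    _▷_    : G.Carrier → X.Carrier → X.Carrier
    ▷-cong : ∀ {g h x y} → g G.≈ h → x X.≈ y → (g ▷ x) X.≈ (h ▷ y)
    ε-act  : ∀ x → (G.ε ▷ x) X.≈ x
    ∙-act  : ∀ g h x → ((g G.∙ h) ▷ x) X.≈ (g ▷ (h ▷ x))

  InOrbit : X.Carrier → Pred X.Carrier 0ℓ
  InOrbit x y = ∃[ g ] y X.≈ (g ▷ x)

  -- Only the identity fixes every point of P; P need not be known to be invariant.
  FaithfulOn : Pred X.Carrier 0ℓ → Set
  FaithfulOn P = ∀ g → (∀ x → P x → (g ▷ x) X.≈ x) → g G.≈ G.ε

module _ (N H : Grp) (φ : Action H (Group.setoid N)) where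
  private
    module N = Group N
    module H = Group H
  open Action φ

  ByAutomorphisms : Set
  ByAutomorphisms = ∀ h m n → (h ▷ (m N.∙ n)) N.≈ ((h ▷ m) N.∙ (h ▷ n))

  semidirect : ByAutomorphisms → Grp
  semidirect φ-homo = record
    { Carrier = N.Carrier × H.Carrier
    ; _≈_     = λ (m , g) (n , h) → m N.≈ n × g H.≈ h
    ; _∙_     = λ (m , g) (n , h) → m N.∙ (g ▷ n) , g H.∙ h
    ; ε       = N.ε , H.ε
    ; _⁻¹     = λ (n , h) → (h H.⁻¹) ▷ (n N.⁻¹) , h H.⁻¹
    ; isGroup = record
      { isMonoid = record
        { isSemigroup = record
          { isMagma = record
            { isEquivalence = record
              { refl  = N.refl , H.refl
              ; sym   = λ (p , q) → N.sym p , H.sym q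
              ; trans = λ (p , q) (r , s) → N.trans p r , H.trans q s
              }
            ; ∙-cong = λ (p , q) (r , s) → N.∙-cong p (▷-cong q r) , H.∙-cong q s
            }
          ; assoc = λ (l , f) (m , g) (n , h) →
              N.trans (N.assoc l (f ▷ m) ((f H.∙ g) ▷ n))
                (N.∙-congˡ (N.trans (N.∙-congˡ (∙-act f g n))
                                    (N.sym (φ-homo f m (g ▷ n)))))
            , H.assoc f g h
          }
        ; identity =
            (λ (n , h) → N.trans (N.identityˡ _) (ε-act n) , H.identityˡ h)
          , (λ (n , h) → N.trans (N.∙-congˡ (▷-ε h)) (N.identityʳ n) , H.identityʳ h)
        }
      ; inverse =
          (λ (n , h) → N.trans (N.sym (φ-homo (h H.⁻¹) (n N.⁻¹) n))
                         (N.trans (▷-cong H.refl (N.inverseˡ n)) (▷-ε (h H.⁻¹)))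
                     , H.inverseˡ h)
        , (λ (n , h) → N.trans (N.∙-congˡ (N.trans (N.sym (∙-act h (h H.⁻¹) (n N.⁻¹)))
                         (N.trans (▷-cong (H.inverseʳ h) N.refl) (ε-act (n N.⁻¹)))))
                         (N.inverseʳ n)
                     , H.inverseʳ h)
      ; ⁻¹-cong = λ (p , q) → ▷-cong (H.⁻¹-cong q) (N.⁻¹-cong p) , H.⁻¹-cong q
      }
    }
    where
    ▷-ε : ∀ h → (h ▷ N.ε) N.≈ N.ε
    ▷-ε h = identityʳ-unique (h ▷ N.ε) (h ▷ N.ε)
              (N.trans (N.sym (φ-homo h N.ε N.ε)) (▷-cong H.refl (N.identityˡ N.ε)))
      where open import Algebra.Properties.Group N using (identityʳ-unique)

Sym : Set → Grp
Sym A = record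
  { Carrier = A ↔ A
  ; _≈_     = λ f g → ∀ x → to f x ≡ to g x
  ; _∙_     = _↔-∘_
  ; ε       = ↔-id A
  ; _⁻¹     = ↔-sym
  ; isGroup = record
    { isMonoid = record
      { isSemigroup = record
        { isMagma = record
          { isEquivalence = record
            { refl  = λ _ → refl
            ; sym   = λ p x → sym (p x)
            ; trans = λ p q x → trans (p x) (q x)
            }
          ; ∙-cong = λ {f} {f′} {g} {g′} p q x → trans (cong (to f) (q x)) (p (to g′ x))
          }
        ; assoc = λ _ _ _ _ → refl
        }
      ; identity = (λ _ _ → refl) , (λ _ _ → refl)
      }
    ; inverse = strictlyInverseʳ , strictlyInverseˡ
    ; ⁻¹-cong = λ {f} {g} → from-≗ f g
    }
  }
  where
  from-≗ : (f g : A ↔ A) → (∀ x → to f x ≡ to g x) → ∀ x → from f x ≡ from g x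
  from-≗ f g p x = trans (cong (from f) (sym (trans (p (from g x)) (strictlyInverseˡ g x))))
                         (strictlyInverseʳ f (from g x))

S : ℕ → Grp
S n = Sym (Fin n)

C₂^_ : ℕ → Grp
C₂^ n = Pointwise.group (Fin n) Sign.*-group

permuteCoordinates : ∀ n → Action (S n) (Group.setoid (C₂^ n))
permuteCoordinates n = record
  { _▷_    = λ σ v → v ∘ from σ
  ; ▷-cong = λ {σ} {τ} {v} p q i →
               trans (cong v (Group.⁻¹-cong (S n) {σ} {τ} p i)) (q (from τ i))
  ; ε-act  = λ _ _ → refl
  ; ∙-act  = λ _ _ _ _ → refl
  }

C₂ⁿ⋊Sₙ : ℕ → Grp
C₂ⁿ⋊Sₙ n = semidirect (C₂^ n) (S n) (permuteCoordinates n) λ _ _ _ _ → refl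

-- (s , i) stands for the signed index s(i+1) ∈ {±1, …, ±n}.
SignedIndex : ℕ → Set
SignedIndex n = Sign × Fin n

negate : ∀ {n} → SignedIndex n → SignedIndex n
negate = map₁ Sign.opposite

IsSignedPermutation : ∀ {n} → Pred (SignedIndex n ↔ SignedIndex n) 0ℓ
IsSignedPermutation π = ∀ x → to π (negate x) ≡ negate (to π x)

W[B_] : ℕ → Grp
W[B n ] = subgroup (Sym (SignedIndex n)) IsSignedPermutation
  (λ {π} {ρ} p q x → trans (cong (to π) (q x)) (p (to ρ x)))
  (λ _ → refl)
  (λ {π} p x → trans (cong (from π ∘ negate) (sym (strictlyInverseˡ π x)))
                 (trans (cong (from π) (sym (p (from π x))))
                        (strictlyInverseʳ π (negate (from π x)))))

record SimpleGraph : Set₁ where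
  field
    Vertex    : Set
    Adj       : Rel Vertex 0ℓ
    symmetric : Symmetric Adj
    loopless  : ∀ v → ¬ Adj v v

open SimpleGraph public using (Vertex)

module _ (G H : SimpleGraph) where
  private
    module G = SimpleGraph G
    module H = SimpleGraph H

  IsGraphIso : Pred (G.Vertex ↔ H.Vertex) 0ℓ
  IsGraphIso f = ∀ u v → G.Adj u v ⇔ H.Adj (to f u) (to f v)

  GraphIso : Set
  GraphIso = Σ (G.Vertex ↔ H.Vertex) IsGraphIso

  infixl 6 _□_
  _□_ : SimpleGraph
  _□_ = record
    { Vertex    = G.Vertex × H.Vertex
    ; Adj       = λ (u , x) (v , y) → (u ≡ v × H.Adj x y) ⊎ (G.Adj u v × x ≡ y)
    ; symmetric = λ { (inj₁ (p , a)) → inj₁ (sym p , H.symmetric a)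
                    ; (inj₂ (a , p)) → inj₂ (G.symmetric a , sym p) }
    ; loopless  = λ { (_ , x) (inj₁ (_ , a)) → H.loopless x a
                    ; (u , _) (inj₂ (a , _)) → G.loopless u a }
    }

module _ (G H K : SimpleGraph) where

  graphIso-∘ : GraphIso H K → GraphIso G H → GraphIso G K
  graphIso-∘ (g , g-iso) (f , f-iso) =
    g ↔-∘ f , λ u v → g-iso (to f u) (to f v) ⇔-∘ f-iso u v

module _ (G H : SimpleGraph) where
  private
    module H = SimpleGraph H

  graphIso-sym : GraphIso G H → GraphIso H G
  graphIso-sym (f , f-iso) = ↔-sym f , λ u v →
    ⇔-sym (f-iso (from f u) (from f v))
      ⇔-∘ mk⇔ (subst₂ H.Adj (sym (strictlyInverseˡ f u)) (sym (strictlyInverseˡ f v)))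
              (subst₂ H.Adj (strictlyInverseˡ f u) (strictlyInverseˡ f v))

Aut : SimpleGraph → Grp
Aut G = subgroup (Sym (Vertex G)) (IsGraphIso G G)
  (λ {f} {g} p q → proj₂ (graphIso-∘ G G G (f , p) (g , q)))
  (λ _ _ → ⇔-id _)
  (λ {f} p → proj₂ (graphIso-sym G G (f , p)))

conjugate : ∀ G H → GraphIso G H → Group.Carrier (Aut G) → Group.Carrier (Aut H)
conjugate G H θ g =
  graphIso-∘ H G H θ (graphIso-∘ H G G g (graphIso-sym G H θ))

infixl 6 _⊕_
_⊕_ : ∀ {n} .{{_ : NonZero n}} → Fin n → Fin n → Fin n
_⊕_ {n} i j = (toℕ i + toℕ j) mod n

C₄ : SimpleGraph
C₄ = record
  { Vertex    = Fin 4
  ; Adj       = λ i j → j ≡ i ⊕ 1F ⊎ i ≡ j ⊕ 1F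
  ; symmetric = swap
  ; loopless  = λ { 0F (inj₁ ()) ; 0F (inj₂ ())
                  ; 1F (inj₁ ()) ; 1F (inj₂ ())
                  ; 2F (inj₁ ()) ; 2F (inj₂ ())
                  ; 3F (inj₁ ()) ; 3F (inj₂ ()) }
  }

Q : ℕ → SimpleGraph
Q n = record
  { Vertex    = Vec Bool n
  ; Adj       = λ u v → ∃[ i ] lookup u i ≢ lookup v i
                             × (∀ j → j ≢ i → lookup u j ≡ lookup v j)
  ; symmetric = λ (i , p , q) → i , p ∘ sym , λ j r → sym (q j r)
  ; loopless  = λ _ (_ , p , _) → p refl
  }

-- Positions are pairs (row , column), both counted from 0.
Position : Set
Position = Vertex (C₄ □ C₄)

record Arrangement : Set where
  field
    entry     : Position → ℕ
    injective : ∀ p q → entry p ≡ entry q → p ≡ q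
    range     : ∀ p → 1 ≤ entry p × entry p ≤ 16
    onto      : ∀ k → 1 ≤ k → k ≤ 16 → ∃[ p ] entry p ≡ k

open Arrangement

arrangements : Setoid 0ℓ 0ℓ
arrangements = record
  { Carrier       = Arrangement
  ; _≈_           = λ s t → ∀ p → entry s p ≡ entry t p
  ; isEquivalence = record
    { refl  = λ _ → refl
    ; sym   = λ e p → sym (e p)
    ; trans = λ e f p → trans (e p) (f p)
    }
  }

∑ : ∀ {n} → Vector ℕ n → ℕ
∑ = sum ℕ.+-0-monoid

record MostPerfect (s : Arrangement) : Set where
  field
    rows          : ∀ i → ∑ (λ j → entry s (i , j)) ≡ 34
    columns       : ∀ j → ∑ (λ i → entry s (i , j)) ≡ 34
    subsquares    : ∀ i j → entry s (i , j)      + entry s (i , j ⊕ 1F)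
                          + entry s (i ⊕ 1F , j) + entry s (i ⊕ 1F , j ⊕ 1F) ≡ 34
    -- k = 0 gives the two main diagonals.
    diagonals     : ∀ k → ∑ (λ i → entry s (i , i ⊕ k)) ≡ 34
    antidiagonals : ∀ k → ∑ (λ i → entry s (i , opposite i ⊕ k)) ≡ 34

mostPerfectSquares : Setoid 0ℓ 0ℓ
mostPerfectSquares = On.setoid {B = Σ Arrangement MostPerfect} arrangements proj₁

permutePositions : Action (Aut (C₄ □ C₄)) arrangements
permutePositions = record
  { _▷_    = λ (g , _) s → record
    { entry     = entry s ∘ from g
    ; injective = λ p q e →
        trans (sym (strictlyInverseˡ g p))
          (trans (cong (to g) (injective s (from g p) (from g q) e)) (strictlyInverseˡ g q))
    ; range     = range s ∘ from g
    ; onto      = λ k l u → let (p , e) = onto s k l u in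
        to g p , trans (cong (entry s) (strictlyInverseʳ g p)) e
    }
  ; ▷-cong = λ {g} {h} {s} {t} e f p →
      trans (cong (entry s) (Group.⁻¹-cong (Sym Position) {proj₁ g} {proj₁ h} e p))
            (f (from (proj₁ h) p))
  ; ε-act  = λ _ _ → refl
  ; ∙-act  = λ _ _ _ _ → refl
  }

khajurahoRows : Vec (Vec ℕ 4) 4
khajurahoRows = ( 7 ∷ 12 ∷  1 ∷ 14 ∷ [])
              ∷ ( 2 ∷ 13 ∷  8 ∷ 11 ∷ [])
              ∷ (16 ∷  3 ∷ 10 ∷  5 ∷ [])
              ∷ ( 9 ∷  6 ∷ 15 ∷  4 ∷ []) ∷ []

khajuraho : Arrangement
khajuraho = record
  { entry     = k
  ; injective = λ (i , j) (i′ , j′) → toWitness {a? = injective?} _ i j i′ j′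
  ; range     = λ (i , j) → toWitness {a? = range?} _ i j
  ; onto      = λ n 1≤n n≤16 →
      let (i , j , e) = toWitness {a? = onto?} _ (s≤s n≤16) 1≤n in (i , j) , e
  }
  where
  k : Position → ℕ
  k (i , j) = lookup (lookup khajurahoRows i) j

  injective? = Fin.all? λ i → Fin.all? λ j → Fin.all? λ i′ → Fin.all? λ j′ →
    (k (i , j) ℕ.≟ k (i′ , j′)) →-dec ≡-dec Fin._≟_ Fin._≟_ (i , j) (i′ , j′)

  range? = Fin.all? λ i → Fin.all? λ j → (1 ℕ.≤? k (i , j)) ×-dec (k (i , j) ℕ.≤? 16)

  onto? = ℕ.allUpTo? (λ n → (1 ℕ.≤? n) →-dec
    Fin.any? λ i → Fin.any? λ j → k (i , j) ℕ.≟ n) 17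

{-# OPTIONS --safe #-}

-- Under the Gray code the rows, columns and 2 × 2 subsquares of the torus are
-- the 24 squares of Q 4, so a most-perfect square is a bijection from the
-- vertices of Q 4 to 1, …, 16 with sum 34 on every square and 17 on every
-- antipodal pair, a condition visibly invariant under Aut (Q 4). Such a
-- labelling is determined by its values at a vertex and at the neighbours of
-- that vertex, and the neighbours of 16 are necessarily 2, 3, 5, 9. Since
-- Aut (Q 4) acts on pairs of a vertex and an ordering of its neighbours simply
-- transitively, the labellings form one orbit, and the action on them is free
-- because the entries are distinct.

module Submission where

open import Defs
open import Level using (0ℓ)
open import Algebra.Bundles using (Group)
import Algebra.Morphism.Construct.Composition as Composition
open import Algebra.Morphism.Structures using (module GroupMorphisms)
open import Data.Bool.Base using (Bool; true; false; not)
import Data.Bool.Properties as Bool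
open import Data.Bool.Properties using (not-involutive; ¬-not; not-¬)
open import Data.Fin.Base
  using (Fin; zero; suc; combine; quotient; remainder; finToFun; funToFin; punchIn)
open import Data.Fin.Patterns using (0F; 1F; 2F; 3F)
import Data.Fin.Permutation as Perm
import Data.Fin.Properties as Fin
open import Data.List.Base as List using (List; []; _∷_; _++_; cartesianProductWith; allFin)
import Data.List.Membership.DecPropositional as DecMembership
open import Data.List.Membership.Propositional using (_∈_)
import Data.List.Membership.Propositional.Properties as Membership
import Data.List.Properties as List
open import Data.List.Relation.Binary.Permutation.Propositional
  using (_↭_; ↭-sym; ↭-trans; ↭-reflexive)
open import Data.List.Relation.Binary.Permutation.Propositional.Properties using (map⁺)
open import Data.List.Sort.Base using (module SortingAlgorithm)
open import Data.List.Sort.MergeSort using (mergeSort)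
open import Data.Nat.Base
  using (ℕ; zero; suc; _+_; _*_; _∸_; _^_; _!; _≤_; _<_; z≤n; s≤s)
open import Data.Nat.ListAction using (sum)
open import Data.Nat.ListAction.Properties using (sum-↭)
import Data.Nat.Properties as ℕ
open import Data.Nat.Solver using (module +-*-Solver)
open import Data.Product.Base
  using (Σ-syntax; ∃-syntax; _×_; _,_; proj₁; proj₂; uncurry)
open import Data.Product.Properties using (≡-dec)
open import Data.Product.Relation.Binary.Pointwise.NonDependent using (×-setoid)
open import Data.Sign.Base as Sign using (Sign)
import Data.Sign.Properties as Sign
open import Data.Sum.Base using (inj₁; inj₂)
open import Data.Vec.Base as Vec using (Vec; []; _∷_; lookup; tabulate; replicate; updateAt)
open import Data.Vec.Properties
  using (lookup∘tabulate; tabulate∘lookup; tabulate-cong; lookup-replicate; lookup-map;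
         lookup∘updateAt; lookup∘updateAt′; updateAt-updateAt; updateAt-id-local)
open import Function.Base using (_∘_)
open import Function.Bundles using (Inverse; Equivalence; _↔_; _⇔_; mk⇔; mk↔ₛ′)
import Function.Construct.Composition as Compose
import Function.Construct.Identity as Identity
open import Function.Construct.Symmetry using (↔-sym)
open import Relation.Binary.Bundles using (Setoid)
import Relation.Binary.Construct.On as On
open import Relation.Binary.PropositionalEquality
  using (_≡_; _≢_; refl; sym; trans; cong; cong₂; subst; ≢-sym; setoid; module ≡-Reasoning)
open import Relation.Nullary.Decidable
  using (Dec; yes; no; toWitness; ¬?; _×-dec_; _⊎-dec_; _→-dec_)
open import Relation.Nullary.Negation using (contradiction)

open Inverse using (to; from; strictlyInverseˡ; strictlyInverseʳ)
open Arrangement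
open MostPerfect

-- Isomorphisms and orders of groups

-- The square sums alone do not give the antipodal sums. They only show that the sum of an antipodal
-- pair depends on the parity of the vertex, the values for the two parities adding up to 34. One
-- diagonal, made of two pairs of equal parity, fixes both values at 17. The values 2, 3, 5, 9 are
-- binary counting in disguise. Take the vertex of 16 as origin and let `c i` be one less than the
-- label of its neighbour in direction `i`. The vertex reached by flipping a set T of directions has
-- label 1 plus the sum of `c` over T if T is odd, and 16 minus that sum if T is even. As the total
-- of `c` is 15, the labels are the numbers 1 plus a subset sum of `c`, and these are distinct only
-- if `c` is 1, 2, 4, 8 in some order. Simple transitivity rests on one fact about automorphisms of
-- the cube: parallel edges have parallel images.

module _ (G H : Grp) where
  private
    module G = Group G
    module H = Group H
  open GroupMorphisms G.rawGroup H.rawGroup using () renaming (module IsGroupIsomorphism to Iso)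
  open import Algebra.Properties.Group H using (identityʳ-unique; inverseˡ-unique)

  isGroupIsomorphism : (f : G.Carrier → H.Carrier) →
                       (∀ {x y} → x G.≈ y → f x H.≈ f y) →
                       (∀ x y → f (x G.∙ y) H.≈ (f x H.∙ f y)) →
                       (∀ {x y} → f x H.≈ f y → x G.≈ y) →
                       (∀ y → ∃[ x ] f x H.≈ y) →
                       IsGroupIsomorphism G H f
  isGroupIsomorphism f f-cong f-homo f-injective f-surjective = record
    { isGroupMonomorphism = record
      { isGroupHomomorphism = record
        { isMonoidHomomorphism = record
          { isMagmaHomomorphism = record
            { isRelHomomorphism = record { cong = f-cong }
            ; homo              = f-homo
            }
          ; ε-homo = ε-homo
          }
        ; ⁻¹-homo = λ x → inverseˡ-unique (f (x G.⁻¹)) (f x)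
            (H.trans (H.sym (f-homo _ _)) (H.trans (f-cong (G.inverseˡ x)) ε-homo))
        }
      ; injective = f-injective
      }
    ; surjective = λ y → let (x , fx≈y) = f-surjective y in
        x , λ z≈x → H.trans (f-cong z≈x) fx≈y
    }
    where
    ε-homo : f G.ε H.≈ H.ε
    ε-homo = identityʳ-unique (f G.ε) (f G.ε)
               (H.trans (H.sym (f-homo _ _)) (f-cong (G.identityˡ G.ε)))

  ≅⇒Inverse : G ≅ H → Inverse G.setoid H.setoid
  ≅⇒Inverse (f , iso) = record
    { to        = f
    ; from      = f⁻¹
    ; to-cong   = Iso.⟦⟧-cong iso
    ; from-cong = λ {x} {y} x≈y → Iso.injective iso
        (H.trans (f-f⁻¹ x) (H.trans x≈y (H.sym (f-f⁻¹ y))))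
    ; inverse   = (λ {x} y≈f⁻¹x → H.trans (Iso.⟦⟧-cong iso y≈f⁻¹x) (f-f⁻¹ x))
                , (λ {x} {y} y≈fx → Iso.injective iso (H.trans (f-f⁻¹ y) y≈fx))
    }
    where
    f⁻¹ : H.Carrier → G.Carrier
    f⁻¹ y = proj₁ (Iso.surjective iso y)

    f-f⁻¹ : ∀ y → f (f⁻¹ y) H.≈ y
    f-f⁻¹ y = proj₂ (Iso.surjective iso y) G.refl

  ≅⇒Order : ∀ {n} → G ≅ H → Order G n → Order H n
  ≅⇒Order G≅H order = Compose.inverse order (≅⇒Inverse G≅H)

≅-sym : ∀ G H → G ≅ H → H ≅ G
≅-sym G H G≅H@(f , iso) = f⁻¹.from , isGroupIsomorphism H G f⁻¹.from f⁻¹.from-cong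
  (λ x y → f.injective (H.trans (f⁻¹.strictlyInverseˡ (x H.∙ y))
     (H.sym (H.trans (f.∙-homo _ _)
       (H.∙-cong (f⁻¹.strictlyInverseˡ x) (f⁻¹.strictlyInverseˡ y))))))
  (λ {x} {y} p → H.trans (H.sym (f⁻¹.strictlyInverseˡ x))
     (H.trans (f⁻¹.to-cong p) (f⁻¹.strictlyInverseˡ y)))
  (λ x → f x , f⁻¹.strictlyInverseʳ x)
  where
  module G = Group G
  module H = Group H
  module f⁻¹ = Inverse (≅⇒Inverse G H G≅H)
  module f = GroupMorphisms.IsGroupIsomorphism iso

≅-trans : ∀ G H K → G ≅ H → H ≅ K → G ≅ K
≅-trans G H K (f , f-iso) (g , g-iso) =
  g ∘ f , Composition.isGroupIsomorphism (Group.trans K) f-iso g-iso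

module _ {X Y : Setoid 0ℓ 0ℓ} where
  private
    module X = Setoid X
    module Y = Setoid Y

  ×-HasCardinality : ∀ {m n} → HasCardinality X m → HasCardinality Y n →
                     HasCardinality (×-setoid X Y) (m * n)
  ×-HasCardinality {m} {n} x y = record
    { to        = λ k → to x (quotient n k) , to y (remainder {m} n k)
    ; from      = λ (u , v) → combine (from x u) (from y v)
    ; to-cong   = λ { refl → X.refl , Y.refl }
    ; from-cong = λ (p , q) → cong₂ combine (Inverse.from-cong x p) (Inverse.from-cong y q)
    ; inverse   = (λ { {u , v} refl →
          X.trans (X.reflexive (cong (to x ∘ proj₁) (Fin.remQuot-combine (from x u) (from y v))))
                  (strictlyInverseˡ x u)
        , Y.trans (Y.reflexive (cong (to y ∘ proj₂) (Fin.remQuot-combine (from x u) (from y v))))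
                  (strictlyInverseˡ y v) })
                , (λ {k} (p , q) → trans
                     (cong₂ combine (Inverse.inverseʳ x p) (Inverse.inverseʳ y q))
                     (Fin.combine-remQuot {m} n k))
    }

order-semidirect : ∀ N H φ homo {m n} → Order N m → Order H n →
                   Order (semidirect N H φ homo) (m * n)
-- The twist affects only the multiplication; carrier and equality are those of the direct product.
order-semidirect N H φ homo p q = record { Inverse (×-HasCardinality p q) }

Sign-HasCardinality : HasCardinality (setoid Sign) 2
Sign-HasCardinality = record
  { to = λ { 0F → Sign.+ ; 1F → Sign.- }
  ; from = λ { Sign.+ → 0F ; Sign.- → 1F }
  ; to-cong = cong _
  ; from-cong = cong _
  ; inverse = (λ { {Sign.+} refl → refl ; {Sign.-} refl → refl })
            , (λ { {0F} refl → refl ; {1F} refl → refl })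
  }

funToFin-cong : ∀ {m n} {f g : Fin m → Fin n} → (∀ i → f i ≡ g i) → funToFin f ≡ funToFin g
funToFin-cong {zero}  p = refl
funToFin-cong {suc m} p = cong₂ combine (p 0F) (funToFin-cong (p ∘ suc))

order-C₂^ : ∀ n → Order (C₂^ n) (2 ^ n)
order-C₂^ n = record
  { to        = λ k → to Sign-HasCardinality ∘ finToFun k
  ; from      = λ v → funToFin (from Sign-HasCardinality ∘ v)
  ; to-cong   = λ { refl _ → refl }
  ; from-cong = λ p → funToFin-cong (cong (from Sign-HasCardinality) ∘ p)
  ; inverse   = (λ { {v} refl i → trans
                    (cong (to Sign-HasCardinality) (Fin.finToFun-funToFin _ i))
                    (strictlyInverseˡ Sign-HasCardinality (v i)) })
              , (λ {k} p → trans
                    (funToFin-cong (λ i → Inverse.inverseʳ Sign-HasCardinality (p i)))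
                    (Fin.funToFin-finToFin {n} k))
  }

remove-cong : ∀ {n} (i : Fin (suc n)) (π ρ : Perm.Permutation′ (suc n)) →
              π Perm.≈ ρ → Perm.remove i π Perm.≈ Perm.remove i ρ
remove-cong i π ρ p j = Fin.punchIn-injective (to π i) _ _
  (trans (Fin.punchIn-punchOut _)
    (trans (p _) (trans (sym (Fin.punchIn-punchOut _)) (cong (λ k → punchIn k _) (sym (p i))))))

insert-cong : ∀ {n} (i : Fin (suc n)) {j k} (π ρ : Perm.Permutation′ n) →
              j ≡ k → π Perm.≈ ρ → Perm.insert i j π Perm.≈ Perm.insert i k ρ
insert-cong i {j} π ρ refl p l with i Fin.≟ l
... | yes _ = refl
... | no _  = cong (punchIn j) (p _)

insert-at : ∀ {n} (i j : Fin (suc n)) (π : Perm.Permutation′ n) → to (Perm.insert i j π) i ≡ j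
insert-at i j π with i Fin.≟ i
... | yes _ = refl
... | no i≢i with () ← i≢i refl

-- The factorial recursion: a permutation amounts to the image of `0F` together with the permutation
-- left after deleting `0F` and its image.
order-S : ∀ n → Order (S n) (n !)
order-S zero = record
  { to        = λ _ → Perm.id
  ; from      = λ _ → 0F
  ; to-cong   = λ _ ()
  ; from-cong = λ _ → refl
  ; inverse   = (λ _ ()) , λ { {0F} _ → refl }
  }
order-S (suc n) = Compose.inverse
  (×-HasCardinality (Identity.inverse (setoid (Fin (suc n)))) (order-S n)) insertion
  where
  insertion : Inverse (×-setoid (setoid (Fin (suc n))) (Group.setoid (S n)))
                      (Group.setoid (S (suc n)))
  insertion = record
    { to        = λ (k , π) → Perm.insert 0F k π
    ; from      = λ π → to π 0F , Perm.remove 0F π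
    ; to-cong   = λ {x} {y} (p , q) → insert-cong 0F (proj₂ x) (proj₂ y) p q
    ; from-cong = λ {π} {ρ} p → p 0F , remove-cong 0F π ρ p
    ; inverse   = (λ {π} {x} (p , q) i → trans (insert-cong 0F (proj₂ x) (Perm.remove 0F π) p q i)
                                       (Perm.insert-remove 0F π i))
                , (λ {(k , π)} {ρ} p →
                     trans (p 0F) (insert-at 0F k π)
                   , λ i → trans (remove-cong 0F ρ (Perm.insert 0F k π) p i)
                                 (Perm.remove-insert 0F k π i))
    }

-- Automorphisms of the hypercube

↔-injective : ∀ {A B : Set} (f : A ↔ B) {x y} → to f x ≡ to f y → x ≡ y
↔-injective f {x} {y} p =
  trans (sym (strictlyInverseʳ f x)) (trans (cong (from f) p) (strictlyInverseʳ f y))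

complement : ∀ {n} → Vec Bool n → Vec Bool n
complement = Vec.map not

module _ {n : ℕ} where

  flip : Fin n → Vec Bool n → Vec Bool n
  flip i x = updateAt x i not

  lookup-flip : ∀ i x → lookup (flip i x) i ≡ not (lookup x i)
  lookup-flip i x = lookup∘updateAt i x

  lookup-flip-≢ : ∀ {i j} x → i ≢ j → lookup (flip j x) i ≡ lookup x i
  lookup-flip-≢ x i≢j = lookup∘updateAt′ _ _ i≢j x

  lookup-extensional : ∀ {x y : Vec Bool n} → (∀ i → lookup x i ≡ lookup y i) → x ≡ y
  lookup-extensional {x} {y} p =
    trans (sym (tabulate∘lookup x)) (trans (tabulate-cong p) (tabulate∘lookup y))

  flip-involutive : ∀ i x → flip i (flip i x) ≡ x
  flip-involutive i x = trans (updateAt-updateAt i x) (updateAt-id-local i x (not-involutive _))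

  flip-injective : ∀ {i j} x → flip i x ≡ flip j x → i ≡ j
  flip-injective {i} {j} x p with i Fin.≟ j
  ... | yes i≡j = i≡j
  ... | no i≢j  = contradiction
    (trans (sym (lookup-flip-≢ x i≢j)) (trans (cong (λ y → lookup y i) (sym p)) (lookup-flip i x)))
    (not-¬ refl)

flip-commutes : ∀ {n} (i j : Fin n) x → flip i (flip j x) ≡ flip j (flip i x)
flip-commutes zero    zero    x       = refl
flip-commutes zero    (suc j) (b ∷ x) = refl
flip-commutes (suc i) zero    (b ∷ x) = refl
flip-commutes (suc i) (suc j) (b ∷ x) = cong (b ∷_) (flip-commutes i j x)

-- Connectivity of the cube as an induction principle: `x` is turned into `y` by correcting the tail
-- and finally, where needed, the head.
flip-induction : ∀ {n} (P : Vec Bool n → Set) → (∀ i x → P x → P (flip i x)) →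
                 ∀ {x} → P x → ∀ y → P y
flip-induction P step {[]}    px []      = px
flip-induction P step {b ∷ x} px (c ∷ y) = adjust b c
  (flip-induction (P ∘ (b ∷_)) (λ i z → step (suc i) (b ∷ z)) px y)
  where
  adjust : ∀ b c → P (b ∷ y) → P (c ∷ y)
  adjust false false = λ p → p
  adjust false true  = step zero _
  adjust true  false = step zero _
  adjust true  true  = λ p → p

module _ {n : ℕ} where
  open SimpleGraph (Q n) using (Adj)

  adj-flip : ∀ i x → Adj x (flip i x)
  adj-flip i x = i , (λ p → not-¬ refl (trans p (lookup-flip i x)))
                   , λ j j≢i → sym (lookup-flip-≢ x j≢i)

  adj⇒flip : ∀ {x y} (a : Adj x y) → y ≡ flip (proj₁ a) x
  adj⇒flip {x} {y} (i , p , q) = lookup-extensional λ k → agree k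
    where
    agree : ∀ k → lookup y k ≡ lookup (flip i x) k
    agree k with k Fin.≟ i
    ... | yes refl = trans (¬-not (≢-sym p)) (sym (lookup-flip i x))
    ... | no k≢i   = trans (sym (q k k≢i)) (sym (lookup-flip-≢ x k≢i))

  -- The map `σ` on directions is the same at every vertex; this uniformity is what has to be proved
  -- for an automorphism.
  _IntertwinesFlipsVia_ : (Vec Bool n → Vec Bool n) → (Fin n → Fin n) → Set
  h IntertwinesFlipsVia σ = ∀ i x → h (flip i x) ≡ flip (σ i) (h x)

  intertwiner-unique : ∀ {h k σ} → h IntertwinesFlipsVia σ → k IntertwinesFlipsVia σ →
                       ∀ {x} → h x ≡ k x → ∀ y → h y ≡ k y
  intertwiner-unique {h} {k} {σ} p q = flip-induction (λ x → h x ≡ k x)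
    λ i x e → trans (p i x) (trans (cong (flip (σ i)) e) (sym (q i x)))

  -- Adjacency is reflected because `σ` is onto: an edge between images in direction `k` comes from
  -- an edge in direction `from σ k`.
  intertwiner⇒IsGraphIso : ∀ f (σ : Fin n ↔ Fin n) → to f IntertwinesFlipsVia to σ →
                           IsGraphIso (Q n) (Q n) f
  intertwiner⇒IsGraphIso f σ p x y = mk⇔
    (λ a → subst (Adj (to f x)) (sym (trans (cong (to f) (adj⇒flip a)) (p _ x)))
                 (adj-flip _ (to f x)))
    (λ a → let k = proj₁ a in
      subst (Adj x) (↔-injective f (trans (p (from σ k) x)
                       (trans (cong (λ j → flip j (to f x)) (strictlyInverseˡ σ k))
                              (sym (adj⇒flip a)))))
            (adj-flip (from σ k) x))

  module _ (f : Vec Bool n ↔ Vec Bool n) (f-iso : IsGraphIso (Q n) (Q n) f) where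
    private
      direction : Vec Bool n → Fin n → Fin n
      direction x i = proj₁ (Equivalence.to (f-iso x (flip i x)) (adj-flip i x))

      f-flip : ∀ i x → to f (flip i x) ≡ flip (direction x i) (to f x)
      f-flip i x = adj⇒flip (Equivalence.to (f-iso x (flip i x)) (adj-flip i x))

      -- The left-hand path changes coordinate `a` exactly once, so the right-hand path must change
      -- it too, and its first step `d` does not.
      parallel-sides : ∀ {a b c d : Fin n} (y : Vec Bool n) → flip b (flip a y) ≡ flip c (flip d y) →
                       a ≢ b → a ≢ d → c ≡ a
      parallel-sides {a} {b} {c} {d} y e a≢b a≢d with c Fin.≟ a
      ... | yes c≡a = c≡a
      ... | no c≢a  = contradiction
        (begin
          lookup y a                   ≡⟨ lookup-flip-≢ y a≢d ⟨
          lookup (flip d y) a          ≡⟨ lookup-flip-≢ (flip d y) (≢-sym c≢a) ⟨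
          lookup (flip c (flip d y)) a ≡⟨ cong (λ z → lookup z a) e ⟨
          lookup (flip b (flip a y)) a ≡⟨ lookup-flip-≢ (flip a y) a≢b ⟩
          lookup (flip a y) a          ≡⟨ lookup-flip a y ⟩
          not (lookup y a)             ∎)
        (not-¬ refl)
        where open ≡-Reasoning

      -- The squares of Q n through an edge make the direction of its image
      -- agree with that of all its translates.
      direction-flip : ∀ i j x → direction (flip j x) i ≡ direction x i
      direction-flip i j x with i Fin.≟ j
      -- This is one edge traversed in both orientations.
      ... | yes refl = flip-injective (to f x)
        (trans (cong (flip (direction (flip i x) i))
                 (trans (cong (to f) (sym (flip-involutive i x)))
                   (trans (f-flip i (flip i x)) (cong (flip _) (f-flip i x)))))
               (flip-involutive _ _))
      ... | no i≢j = parallel-sides (to f x)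
        (begin
          flip (direction (flip i x) j) (flip (direction x i) (to f x))
            ≡⟨ cong (flip _) (f-flip i x) ⟨
          flip (direction (flip i x) j) (to f (flip i x))
            ≡⟨ f-flip j (flip i x) ⟨
          to f (flip j (flip i x))
            ≡⟨ cong (to f) (flip-commutes j i x) ⟩
          to f (flip i (flip j x))
            ≡⟨ f-flip i (flip j x) ⟩
          flip (direction (flip j x) i) (to f (flip j x))
            ≡⟨ cong (flip _) (f-flip j x) ⟩
          flip (direction (flip j x) i) (flip (direction x j) (to f x)) ∎)
        -- Otherwise the image of the path from `x` along `i` and `j` would return to its start, and
        -- injectivity would close the path itself.
        (λ (a≡b : direction x i ≡ direction (flip i x) j) → i≢j (flip-injective x
          (trans (sym (flip-involutive j (flip i x)))
            (cong (flip j) (↔-injective f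
              (trans (f-flip j (flip i x))
                (trans (cong (flip _) (f-flip i x))
                  (trans (cong (λ a → flip (direction (flip i x) j) (flip a (to f x))) a≡b)
                    (flip-involutive _ _)))))))))
        (λ (a≡d : direction x i ≡ direction x j) → i≢j (flip-injective x (↔-injective f
          (trans (f-flip i x)
            (trans (cong (λ a → flip a (to f x)) a≡d) (sym (f-flip j x)))))))
        where open ≡-Reasoning

    automorphism-intertwines : Σ[ σ ∈ (Fin n → Fin n) ] to f IntertwinesFlipsVia σ
    automorphism-intertwines = direction origin , λ i x → trans (f-flip i x)
      (cong (λ k → flip k (to f x))
        (flip-induction (λ y → direction y i ≡ direction origin i)
          (λ j y → trans (direction-flip i j y)) refl x))
      where origin = replicate n false

  -- Compare a single edge: `k ∘ h` sends `flip i origin` to `flip (τ (σ i)) origin`. Applied to an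
  -- automorphism and its inverse, this makes the direction map a permutation.
  intertwiners-inverse : ∀ {h k σ τ} → h IntertwinesFlipsVia σ → k IntertwinesFlipsVia τ →
                         (∀ x → k (h x) ≡ x) → ∀ i → τ (σ i) ≡ i
  intertwiners-inverse {h} {k} p q kh i = flip-injective origin
    (trans (cong (flip _) (sym (kh origin)))
      (trans (sym (q _ (h origin)))
        (trans (cong k (sym (p i origin))) (kh (flip i origin)))))
    where origin = replicate n false

  directionPermutation : ((f , _) : GraphIso (Q n) (Q n)) →
                         Σ[ σ ∈ Fin n ↔ Fin n ] to f IntertwinesFlipsVia to σ
  directionPermutation g@(f , f-iso) =
    let (σ , p) = automorphism-intertwines f f-iso
        (f⁻¹ , f⁻¹-iso) = graphIso-sym (Q n) (Q n) g
        (τ , q) = automorphism-intertwines f⁻¹ f⁻¹-iso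
    in mk↔ₛ′ σ τ (intertwiners-inverse q p (strictlyInverseˡ f))
                 (intertwiners-inverse p q (strictlyInverseʳ f)) , p

-- Signed coordinate permutations as the automorphisms of the cube

infixr 6 _◃_
_◃_ : Sign → Bool → Bool
Sign.+ ◃ b = b
Sign.- ◃ b = not b

◃-* : ∀ s t b → (s Sign.* t) ◃ b ≡ s ◃ t ◃ b
◃-* Sign.+ t      b = refl
◃-* Sign.- Sign.+ b = refl
◃-* Sign.- Sign.- b = sym (not-involutive b)

◃-not : ∀ s b → s ◃ not b ≡ not (s ◃ b)
◃-not Sign.+ b = refl
◃-not Sign.- b = refl

◃-involutive : ∀ s b → s ◃ s ◃ b ≡ b
◃-involutive Sign.+ b = refl
◃-involutive Sign.- b = not-involutive b

◃-injectiveˡ : ∀ s t b → s ◃ b ≡ t ◃ b → s ≡ t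
◃-injectiveˡ Sign.+ Sign.+ b p = refl
◃-injectiveˡ Sign.+ Sign.- b p = contradiction p (not-¬ refl)
◃-injectiveˡ Sign.- Sign.+ b p = contradiction (sym p) (not-¬ refl)
◃-injectiveˡ Sign.- Sign.- b p = refl

◃-transitive : ∀ b c → Σ[ s ∈ Sign ] s ◃ b ≡ c
◃-transitive false false = Sign.+ , refl
◃-transitive false true  = Sign.- , refl
◃-transitive true  false = Sign.- , refl
◃-transitive true  true  = Sign.+ , refl

module _ {n : ℕ} where
  private module C₂ⁿ⋊Sₙ = Group (C₂ⁿ⋊Sₙ n)

  signedPermute : C₂ⁿ⋊Sₙ.Carrier → Vec Bool n → Vec Bool n
  signedPermute (v , σ) x = tabulate λ i → v i ◃ lookup x (from σ i)

  lookup-signedPermute : ∀ (g@(v , σ) : C₂ⁿ⋊Sₙ.Carrier) x i →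
                         lookup (signedPermute g x) i ≡ v i ◃ lookup x (from σ i)
  lookup-signedPermute g x = lookup∘tabulate _

  -- The signs act by a translation of the cube, which keeps every direction, so only `σ` moves
  -- directions.
  signedPermute-flip : ∀ (g@(v , σ) : C₂ⁿ⋊Sₙ.Carrier) → signedPermute g IntertwinesFlipsVia to σ
  signedPermute-flip g@(v , σ) i x = lookup-extensional λ k →
    trans (lookup-signedPermute g (flip i x) k) (agree k)
    where
    agree : ∀ k → v k ◃ lookup (flip i x) (from σ k) ≡ lookup (flip (to σ i) (signedPermute g x)) k
    agree k with k Fin.≟ to σ i
    ... | yes refl rewrite strictlyInverseʳ σ i | lookup-flip i x = begin
        v k ◃ not (lookup x i)                                  ≡⟨ ◃-not (v k) _ ⟩
        not (v k ◃ lookup x i)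
          ≡⟨ cong (λ j → not (v k ◃ lookup x j)) (strictlyInverseʳ σ i) ⟨
        not (v k ◃ lookup x (from σ k))     ≡⟨ cong not (lookup-signedPermute g x k) ⟨
        not (lookup (signedPermute g x) k)  ≡⟨ lookup-flip k (signedPermute g x) ⟨
        lookup (flip k (signedPermute g x)) k ∎
        where open ≡-Reasoning
    ... | no k≢σi = begin
        v k ◃ lookup (flip i x) (from σ k)
          ≡⟨ cong (v k ◃_) (lookup-flip-≢ x λ p →
               k≢σi (trans (sym (strictlyInverseˡ σ k)) (cong (to σ) p))) ⟩
        v k ◃ lookup x (from σ k)           ≡⟨ lookup-signedPermute g x k ⟨
        lookup (signedPermute g x) k        ≡⟨ lookup-flip-≢ (signedPermute g x) k≢σi ⟨
        lookup (flip (to σ i) (signedPermute g x)) k ∎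
        where open ≡-Reasoning

  signedPermute-complement : ∀ g x → signedPermute g (complement x) ≡ complement (signedPermute g x)
  signedPermute-complement g@(v , σ) x = lookup-extensional λ i →
    trans (lookup-signedPermute g (complement x) i)
      (trans (cong (v i ◃_) (lookup-map (from σ i) not x))
        (trans (◃-not (v i) _)
          (trans (cong not (sym (lookup-signedPermute g x i)))
            (sym (lookup-map i not (signedPermute g x))))))

  signedPermute-transitive : ∀ σ x y → ∃[ v ] signedPermute (v , σ) x ≡ y
  signedPermute-transitive σ x y = v , lookup-extensional λ i →
    trans (lookup-signedPermute (v , σ) x i)
          (proj₂ (◃-transitive (lookup x (from σ i)) (lookup y i)))
    where
    v : Fin n → Sign
    v i = proj₁ (◃-transitive (lookup x (from σ i)) (lookup y i))

  signedPermute-∙ : ∀ g h x →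
                    signedPermute (g C₂ⁿ⋊Sₙ.∙ h) x ≡ signedPermute g (signedPermute h x)
  signedPermute-∙ (v , σ) (w , τ) x = tabulate-cong λ i →
    trans (◃-* (v i) (w (from σ i)) _)
          (cong (v i ◃_) (sym (lookup-signedPermute (w , τ) x (from σ i))))

  signedPermute-cong : ∀ {g h} → g C₂ⁿ⋊Sₙ.≈ h → ∀ x → signedPermute g x ≡ signedPermute h x
  signedPermute-cong {v , σ} {w , τ} (p , q) x = tabulate-cong λ i →
    cong₂ (λ s j → s ◃ lookup x j) (p i) (Group.⁻¹-cong (S n) {σ} {τ} q i)

  signedPermute-ε : ∀ x → signedPermute C₂ⁿ⋊Sₙ.ε x ≡ x
  signedPermute-ε = tabulate∘lookup

  -- The image of the origin reveals the signs, and the images of the edges at the origin reveal the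
  -- permutation.
  signedPermute-injective : ∀ {g h} → (∀ x → signedPermute g x ≡ signedPermute h x) →
                            g C₂ⁿ⋊Sₙ.≈ h
  signedPermute-injective {g@(v , σ)} {h@(w , τ)} p =
      (λ i → ◃-injectiveˡ (v i) (w i) false
         (trans (sym (at-origin g i)) (trans (cong (λ x → lookup x i) (p origin)) (at-origin h i))))
    , (λ i → flip-injective (signedPermute g origin)
         (trans (sym (signedPermute-flip g i origin))
           (trans (p (flip i origin))
             (trans (signedPermute-flip h i origin) (cong (flip _) (sym (p origin)))))))
    where
    origin = replicate n false
    at-origin : ∀ (k@(u , ρ) : C₂ⁿ⋊Sₙ.Carrier) i → lookup (signedPermute k origin) i ≡ u i ◃ false
    at-origin k@(u , ρ) i = trans (lookup-signedPermute k origin i)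
                                  (cong (u i ◃_) (lookup-replicate (from ρ i) false))

  signedPermute-↔ : C₂ⁿ⋊Sₙ.Carrier → Vec Bool n ↔ Vec Bool n
  signedPermute-↔ g = mk↔ₛ′ (signedPermute g) (signedPermute (g C₂ⁿ⋊Sₙ.⁻¹))
    (λ x → trans (sym (signedPermute-∙ g (g C₂ⁿ⋊Sₙ.⁻¹) x))
             (trans (signedPermute-cong {g C₂ⁿ⋊Sₙ.∙ g C₂ⁿ⋊Sₙ.⁻¹} {C₂ⁿ⋊Sₙ.ε} (C₂ⁿ⋊Sₙ.inverseʳ g) x)
                    (signedPermute-ε x)))
    (λ x → trans (sym (signedPermute-∙ (g C₂ⁿ⋊Sₙ.⁻¹) g x))
             (trans (signedPermute-cong {g C₂ⁿ⋊Sₙ.⁻¹ C₂ⁿ⋊Sₙ.∙ g} {C₂ⁿ⋊Sₙ.ε} (C₂ⁿ⋊Sₙ.inverseˡ g) x)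
                    (signedPermute-ε x)))

  signedPermute-automorphism : C₂ⁿ⋊Sₙ.Carrier → Group.Carrier (Aut (Q n))
  signedPermute-automorphism g@(v , σ) =
    signedPermute-↔ g , intertwiner⇒IsGraphIso (signedPermute-↔ g) σ (signedPermute-flip g)

  -- An automorphism is determined by its direction permutation and its value at one vertex, and a
  -- signed permutation can be chosen with both prescribed.
  automorphism-signedPermute : ((f , _) : Group.Carrier (Aut (Q n))) →
                               ∃[ g ] (∀ x → signedPermute g x ≡ to f x)
  automorphism-signedPermute fi@(f , _) =
    let (σ , p) = directionPermutation fi
        origin  = replicate n false
        (v , e) = signedPermute-transitive σ origin (to f origin)
    in (v , σ) , intertwiner-unique (signedPermute-flip (v , σ)) p e

C₂ⁿ⋊Sₙ≅AutQ : ∀ n → C₂ⁿ⋊Sₙ n ≅ Aut (Q n)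
C₂ⁿ⋊Sₙ≅AutQ n = signedPermute-automorphism ,
  isGroupIsomorphism (C₂ⁿ⋊Sₙ n) (Aut (Q n)) signedPermute-automorphism
    (λ {g} {h} → signedPermute-cong {n} {g} {h})
    signedPermute-∙
    (λ {g} {h} → signedPermute-injective {n} {g} {h})
    automorphism-signedPermute

-- The hyperoctahedral group as a semidirect product

*-involutive : ∀ s t → s Sign.* (s Sign.* t) ≡ t
*-involutive s t = trans (sym (Sign.*-assoc s s t)) (cong (Sign._* t) (Sign.s*s≡+ s))

opposite-* : ∀ s t → s Sign.* Sign.opposite t ≡ Sign.opposite (s Sign.* t)
opposite-* Sign.+ t      = refl
opposite-* Sign.- Sign.+ = refl
opposite-* Sign.- Sign.- = refl

module _ {n : ℕ} where

  -- The sign is read at the image index `to σ i`, as the left factor in the product of `semidirect`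
  -- requires.
  signedPermutation : Group.Carrier (C₂ⁿ⋊Sₙ n) → Group.Carrier W[B n ]
  signedPermutation (v , σ) = mk↔ₛ′
      (λ (s , i) → v (to σ i) Sign.* s , to σ i)
      (λ (s , j) → v j Sign.* s , from σ j)
      (λ (s , j) → cong₂ _,_
         (trans (cong (λ k → v k Sign.* (v j Sign.* s)) (strictlyInverseˡ σ j)) (*-involutive (v j) s))
         (strictlyInverseˡ σ j))
      (λ (s , i) → cong₂ _,_ (*-involutive (v (to σ i)) s) (strictlyInverseʳ σ i))
    , λ (s , i) → cong (_, to σ i) (opposite-* (v (to σ i)) s)

  signedPermutation-surjective : ∀ π → ∃[ g ] (Group._≈_ W[B n ] (signedPermutation g) π)
  signedPermutation-surjective (π , π-negate) = (v , σ) , λ (s , i) → sym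
    (trans (π-signed s i) (cong (_, to σ i)
      (trans (Sign.*-comm s _)
        (cong (λ k → proj₁ (to π (Sign.+ , k)) Sign.* s) (sym (strictlyInverseʳ σ i))))))
    where
    ρ = proj₁ (Group._⁻¹ W[B n ] (π , π-negate))
    ρ-negate = proj₂ (Group._⁻¹ W[B n ] (π , π-negate))

    signed : ∀ (κ : SignedIndex n ↔ SignedIndex n) → IsSignedPermutation κ → ∀ s i →
             to κ (s , i) ≡ (s Sign.* proj₁ (to κ (Sign.+ , i)) , proj₂ (to κ (Sign.+ , i)))
    signed κ p Sign.+ i = refl
    signed κ p Sign.- i = p (Sign.+ , i)

    π-signed = signed π π-negate

    index : (κ : SignedIndex n ↔ SignedIndex n) → Fin n → Fin n
    index κ i = proj₂ (to κ (Sign.+ , i))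

    -- The inner image may carry a minus sign, but commuting with negation makes the outer index
    -- independent of the sign.
    index-inverse : ∀ κ κ′ → IsSignedPermutation κ → (∀ x → to κ (to κ′ x) ≡ x) →
                    ∀ i → index κ (index κ′ i) ≡ i
    index-inverse κ κ′ p inv i =
      trans (sym (cong proj₂ (signed κ p (proj₁ (to κ′ (Sign.+ , i))) (index κ′ i))))
            (cong proj₂ (inv (Sign.+ , i)))

    σ : Fin n ↔ Fin n
    σ = mk↔ₛ′ (index π) (index ρ) (index-inverse π ρ π-negate (strictlyInverseˡ π))
                                  (index-inverse ρ π ρ-negate (strictlyInverseʳ π))

    v : Fin n → Sign
    v j = proj₁ (to π (Sign.+ , from σ j))

C₂ⁿ⋊Sₙ≅W[B_] : ∀ n → C₂ⁿ⋊Sₙ n ≅ W[B n ]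
C₂ⁿ⋊Sₙ≅W[B n ] = signedPermutation ,
  isGroupIsomorphism (C₂ⁿ⋊Sₙ n) W[B n ] signedPermutation
    (λ { {v , σ} {w , τ} (p , q) (s , i) →
         cong₂ _,_ (cong (Sign._* s) (trans (p (to σ i)) (cong w (q i)))) (q i) })
    (λ { (v , σ) (w , τ) (s , i) → cong (_, to σ (to τ i))
         (trans (Sign.*-assoc (v (to σ (to τ i))) _ s)
           (cong (λ k → v (to σ (to τ i)) Sign.* (w k Sign.* s)) (strictlyInverseʳ σ (to τ i)))) })
    (λ { {v , σ} {w , τ} p →
         (λ j → trans (cong v (sym (strictlyInverseˡ σ j)))
           (trans (Sign.*-cancelʳ-≡ Sign.+ _ _ (cong proj₁ (p (Sign.+ , from σ j))))
             (cong w (trans (sym (cong proj₂ (p (Sign.+ , from σ j)))) (strictlyInverseˡ σ j)))))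
       , λ i → cong proj₂ (p (Sign.+ , i)) })
    signedPermutation-surjective

conjugate-isGroupIsomorphism : ∀ G H θ → IsGroupIsomorphism (Aut G) (Aut H) (conjugate G H θ)
conjugate-isGroupIsomorphism G H θ@(φ , _) = isGroupIsomorphism (Aut G) (Aut H) (conjugate G H θ)
  (λ p x → cong (to φ) (p (from φ x)))
  (λ (f , _) (g , _) x → cong (to φ ∘ to f) (sym (strictlyInverseʳ φ (to g (from φ x)))))
  (λ {(f , _)} {(g , _)} p x → ↔-injective φ
     (trans (cong (to φ ∘ to f) (sym (strictlyInverseʳ φ x)))
       (trans (p (to φ x)) (cong (to φ ∘ to g) (strictlyInverseʳ φ x)))))
  (λ g@(k , _) → conjugate H G (graphIso-sym G H θ) g , λ x →
     trans (strictlyInverseˡ φ _) (cong (to k) (strictlyInverseˡ φ x)))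

-- Most-perfect squares as labellings of the hypercube

-- The Gray code 00, 01, 11, 10 is an isomorphism C₄ → Q 2.
bit₁ bit₂ : Fin 4 → Bool
bit₁ 0F = false
bit₁ 1F = false
bit₁ 2F = true
bit₁ 3F = true
bit₂ 0F = false
bit₂ 1F = true
bit₂ 2F = true
bit₂ 3F = false

fromBits : Bool → Bool → Fin 4
fromBits false false = 0F
fromBits false true  = 1F
fromBits true  true  = 2F
fromBits true  false = 3F

fromBits-bits : ∀ i → fromBits (bit₁ i) (bit₂ i) ≡ i
fromBits-bits 0F = refl
fromBits-bits 1F = refl
fromBits-bits 2F = refl
fromBits-bits 3F = refl

bit₁-fromBits : ∀ a b → bit₁ (fromBits a b) ≡ a
bit₁-fromBits false false = refl
bit₁-fromBits false true  = refl
bit₁-fromBits true  false = refl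
bit₁-fromBits true  true  = refl

bit₂-fromBits : ∀ a b → bit₂ (fromBits a b) ≡ b
bit₂-fromBits false false = refl
bit₂-fromBits false true  = refl
bit₂-fromBits true  false = refl
bit₂-fromBits true  true  = refl

gray-↔ : Position ↔ Vec Bool 4
gray-↔ = mk↔ₛ′
  (λ (i , j) → bit₁ i ∷ bit₂ i ∷ bit₁ j ∷ bit₂ j ∷ [])
  (λ { (a ∷ b ∷ c ∷ d ∷ []) → fromBits a b , fromBits c d })
  (λ { (a ∷ b ∷ c ∷ d ∷ []) →
       cong₂ (λ (a , b) (c , d) → a ∷ b ∷ c ∷ d ∷ [])
         (cong₂ _,_ (bit₁-fromBits a b) (bit₂-fromBits a b))
         (cong₂ _,_ (bit₁-fromBits c d) (bit₂-fromBits c d)) })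
  (λ (i , j) → cong₂ _,_ (fromBits-bits i) (fromBits-bits j))

gray-IsGraphIso : IsGraphIso (C₄ □ C₄) (Q 4) gray-↔
gray-IsGraphIso (i , j) (i′ , j′) =
  let (⇒ , ⇐) = toWitness {a? = iso?} _ i j i′ j′ in mk⇔ ⇒ ⇐
  where
  open SimpleGraph using (Adj)

  adj-C₄? : ∀ i j → Dec (Adj C₄ i j)
  adj-C₄? i j = (j Fin.≟ i ⊕ 1F) ⊎-dec (i Fin.≟ j ⊕ 1F)

  adj-Torus? : ∀ p q → Dec (Adj (C₄ □ C₄) p q)
  adj-Torus? (i , j) (i′ , j′) = (i Fin.≟ i′ ×-dec adj-C₄? j j′)
                           ⊎-dec (adj-C₄? i i′ ×-dec j Fin.≟ j′)

  adj-Q? : ∀ {n} x y → Dec (Adj (Q n) x y)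
  adj-Q? x y = Fin.any? λ i → ¬? (lookup x i Bool.≟ lookup y i)
    ×-dec Fin.all? λ j → ¬? (j Fin.≟ i) →-dec (lookup x j Bool.≟ lookup y j)

  iso? = Fin.all? λ i → Fin.all? λ j → Fin.all? λ i′ → Fin.all? λ j′ →
    let p = (i , j) ; q = (i′ , j′)
        t = adj-Torus? p q ; c = adj-Q? (to gray-↔ p) (to gray-↔ q)
    in (t →-dec c) ×-dec (c →-dec t)

gray : GraphIso (C₄ □ C₄) (Q 4)
gray = gray-↔ , gray-IsGraphIso

complement-flip : ∀ {n} (i : Fin n) x → complement (flip i x) ≡ flip i (complement x)
complement-flip zero    (b ∷ x) = refl
complement-flip (suc i) (b ∷ x) = cong (not b ∷_) (complement-flip i x)

square : ∀ {n} → Vec Bool n → Fin n → Fin n → List (Vec Bool n)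
square x i j = x ∷ flip i x ∷ flip j (flip i x) ∷ flip j x ∷ []

total : ∀ {A : Set} → (A → ℕ) → List A → ℕ
total f xs = sum (List.map f xs)

Balances : (Vec Bool 4 → ℕ) → Set
Balances F = ∀ x {i j} → i ≢ j → total F (square x i j) ≡ 34

record Balanced (F : Vec Bool 4 → ℕ) : Set where
  field
    squares   : Balances F
    antipodes : ∀ x → F x + F (complement x) ≡ 17

open Balanced

module _ {F G : Vec Bool 4 → ℕ} where

  balanced-resp-≗ : (∀ x → F x ≡ G x) → Balanced F → Balanced G
  balanced-resp-≗ F≗G F-balanced = record
    { squares   = λ x {i} {j} i≢j →
        trans (cong sum (List.map-cong (sym ∘ F≗G) (square x i j))) (squares F-balanced x i≢j)
    ; antipodes = λ x → trans (cong₂ _+_ (sym (F≗G x)) (sym (F≗G (complement x))))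
                              (antipodes F-balanced x)
    }

-- Replace the automorphism by a signed permutation: it maps squares to squares, injectivity of its
-- direction permutation keeping the two directions distinct, and it commutes with `complement`.
balanced-∘ : ∀ {F} → Balanced F → ((f , _) : Group.Carrier (Aut (Q 4))) → Balanced (F ∘ to f)
balanced-∘ {F} F-balanced f =
  let (g@(_ , σ) , g≗f) = automorphism-signedPermute f
      g-flip = signedPermute-flip g
  in balanced-resp-≗ (cong F ∘ g≗f) record
    { squares   = λ x {i} {j} i≢j → trans
        (cong sum (cong₂ (λ y z → F (signedPermute g x) ∷ F y ∷ z)
          (g-flip i x)
          (cong₂ (λ y z → F y ∷ F z ∷ [])
            (trans (g-flip j (flip i x)) (cong (flip (to σ j)) (g-flip i x)))
            (g-flip j x))))
        (squares F-balanced (signedPermute g x) (i≢j ∘ ↔-injective σ))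
    ; antipodes = λ x → trans
        (cong (λ y → F (signedPermute g x) + F y) (signedPermute-complement g x))
        (antipodes F-balanced (signedPermute g x))
    }

row column : Fin 4 → List Position
row i = List.tabulate (i ,_)
column j = List.tabulate (_, j)

subsquare : Fin 4 → Fin 4 → List Position
subsquare i j = (i , j) ∷ (i , j ⊕ 1F) ∷ (i ⊕ 1F , j) ∷ (i ⊕ 1F , j ⊕ 1F) ∷ []

lines : List (List Position)
lines = List.map row (allFin 4) ++ List.map column (allFin 4)
     ++ cartesianProductWith subsquare (allFin 4) (allFin 4)

+-reassociate : ∀ a b c d → a + (b + (c + (d + 0))) ≡ a + b + c + d
+-reassociate = solve 4 (λ a b c d → a :+ (b :+ (c :+ (d :+ con 0))) := a :+ b :+ c :+ d) refl
  where open +-*-Solver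

total-line : ∀ s → MostPerfect s → ∀ {l} → l ∈ lines → total (entry s) l ≡ 34
total-line s mp l∈lines with Membership.∈-++⁻ (List.map row (allFin 4)) l∈lines
... | inj₁ p with (i , _ , refl) ← Membership.∈-map⁻ row p = rows mp i
... | inj₂ p with Membership.∈-++⁻ (List.map column (allFin 4)) p
...   | inj₁ q with (j , _ , refl) ← Membership.∈-map⁻ column q = columns mp j
...   | inj₂ q with (i , j , _ , _ , refl) ←
                   Membership.∈-cartesianProductWith⁻ subsquare (allFin 4) (allFin 4) q =
  trans (+-reassociate (entry s (i , j)) _ _ _) (subsquares mp i j)

open SortingAlgorithm
  (mergeSort (On.decTotalOrder (Fin.≤-decTotalOrder 16) (uncurry (combine {4} {4}))))
  using (sort; sort-↭)

-- Decided by evaluation. Sorting the positions in row-major order turns equality up to permutation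
-- into equality of lists.
square-line : ∀ x {i j} → i ≢ j →
              ∃[ l ] l ∈ lines × List.map (from gray-↔) (square x i j) ↭ l
square-line x {i} {j} i≢j =
  let (k , k′) = from gray-↔ x
      (l , l∈lines , e) = Membership.∈-map⁻ sort (toWitness {a? = sorted?} _ k k′ i j i≢j)
  in l , l∈lines , subst (λ y → positions y i j ↭ l) (strictlyInverseˡ gray-↔ x)
       (↭-trans (↭-sym (sort-↭ (positions (to gray-↔ (k , k′)) i j)))
                (↭-trans (↭-reflexive e) (sort-↭ l)))
  where
  open DecMembership (List.≡-dec (≡-dec (Fin._≟_ {4}) (Fin._≟_ {4}))) using (_∈?_)

  positions : Vec Bool 4 → Fin 4 → Fin 4 → List Position
  positions x i j = List.map (from gray-↔) (square x i j)

  sorted? = Fin.all? λ k → Fin.all? λ k′ → Fin.all? λ i → Fin.all? λ j → ¬? (i Fin.≟ j) →-dec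
    sort (positions (to gray-↔ (k , k′)) i j) ∈? List.map sort lines

onCube : Arrangement → Vec Bool 4 → ℕ
onCube s = entry s ∘ from gray-↔

mostPerfect⇒balances : ∀ s → MostPerfect s → Balances (onCube s)
mostPerfect⇒balances s mp x {i} {j} i≢j = total-onCube (square x i j) (square-line x i≢j)
  where
  total-onCube : ∀ xs → ∃[ l ] l ∈ lines × List.map (from gray-↔) xs ↭ l →
                 total (onCube s) xs ≡ 34
  total-onCube xs (l , l∈lines , p) =
    trans (cong sum (List.map-∘ {g = entry s} {f = from gray-↔} xs))
          (trans (sum-↭ (map⁺ (entry s) p)) (total-line s mp l∈lines))

alternate : ∀ {a b c d n} → a + b ≡ n → b + c ≡ n → c + d ≡ n → a + d ≡ n
alternate {a} {b} {c} {d} p q r = trans (cong (_+ d)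
  (ℕ.+-cancelʳ-≡ b a c (trans p (trans (sym q) (ℕ.+-comm b c))))) r

module _ {F : Vec Bool 4 → ℕ} (F-balances : Balances F) where
  private
    edge : Fin 4 → Vec Bool 4 → ℕ
    edge i x = F x + F (flip i x)

    edge-flip : ∀ x {i j} → i ≢ j → edge i x + edge i (flip j x) ≡ 34
    edge-flip x {i} {j} i≢j = begin
      F x + F (flip i x) + (F (flip j x) + F (flip i (flip j x)))
        ≡⟨ cong (λ y → F x + F (flip i x) + (F (flip j x) + F y)) (flip-commutes i j x) ⟩
      F x + F (flip i x) + (F (flip j x) + F (flip j (flip i x)))
        ≡⟨ solve 4 (λ a b c d → a :+ b :+ (c :+ d) := a :+ (b :+ (d :+ (c :+ con 0)))) refl
             (F x) (F (flip i x)) (F (flip j x)) (F (flip j (flip i x))) ⟩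
      total F (square x i j)
        ≡⟨ F-balances x i≢j ⟩
      34 ∎
      where
      open ≡-Reasoning
      open +-*-Solver

    axis : Vec Bool 4 → ℕ
    axis x = F x + F (complement x)

    -- The four vertices regroup into two edges in direction `i`, at `x` and at the vertex three
    -- flips away. Each flip in another direction replaces an edge sum by its difference from 34,
    -- and three is odd.
    axis-flip-via : ∀ x {i j k l} → i ≢ j → i ≢ k → i ≢ l →
                    complement x ≡ flip i (flip j (flip k (flip l x))) →
                    axis x + axis (flip i x) ≡ 34
    axis-flip-via x {i} {j} {k} {l} i≢j i≢k i≢l e = begin
      F x + F (complement x) + (F (flip i x) + F (complement (flip i x)))
        ≡⟨ cong₂ (λ y z → F x + F y + (F (flip i x) + F z)) e
             (trans (complement-flip i x) (trans (cong (flip i) e) (flip-involutive i far))) ⟩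
      F x + F (flip i far) + (F (flip i x) + F far)
        ≡⟨ solve 4 (λ a b c d → a :+ b :+ (c :+ d) := a :+ c :+ (d :+ b)) refl (F x) _ (F (flip i x)) _ ⟩
      edge i x + edge i far
        ≡⟨ alternate {edge i x} {edge i (flip l x)} (edge-flip x i≢l)
             (edge-flip (flip l x) i≢k) (edge-flip (flip k (flip l x)) i≢j) ⟩
      34 ∎
      where
      open ≡-Reasoning
      open +-*-Solver
      far = flip j (flip k (flip l x))

    axis-flip : ∀ i x → axis x + axis (flip i x) ≡ 34
    axis-flip 0F x@(_ ∷ _ ∷ _ ∷ _ ∷ []) = axis-flip-via x {0F} {1F} {2F} {3F} (λ ()) (λ ()) (λ ()) refl
    axis-flip 1F x@(_ ∷ _ ∷ _ ∷ _ ∷ []) = axis-flip-via x {1F} {0F} {2F} {3F} (λ ()) (λ ()) (λ ()) refl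
    axis-flip 2F x@(_ ∷ _ ∷ _ ∷ _ ∷ []) = axis-flip-via x {2F} {0F} {1F} {3F} (λ ()) (λ ()) (λ ()) refl
    axis-flip 3F x@(_ ∷ _ ∷ _ ∷ _ ∷ []) = axis-flip-via x {3F} {0F} {1F} {2F} (λ ()) (λ ()) (λ ()) refl

  -- By axis-flip the sum over an antipodal pair depends only on the parity of
  -- the pair, and two distinct pairs of the same parity add up to 34.
  balanced-from-diagonal : ∀ x {i j} → axis x + axis (flip i (flip j x)) ≡ 34 → Balanced F
  balanced-from-diagonal x {i} {j} diagonal = record
    { squares   = F-balances
    ; antipodes = flip-induction (λ y → axis y ≡ 17) step axis-x
    }
    where
    axis-x : axis x ≡ 17
    axis-x = ℕ.*-cancelˡ-≡ _ 17 2 (trans (cong (axis x +_) (ℕ.+-identityʳ (axis x)))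
      (trans (cong (axis x +_) (ℕ.+-cancelʳ-≡ (axis (flip j x)) _ _
                (trans (axis-flip j x) (trans (sym (axis-flip i (flip j x)))
                  (ℕ.+-comm (axis (flip j x)) _)))))
             diagonal))

    step : ∀ i y → axis y ≡ 17 → axis (flip i y) ≡ 17
    step i y p = ℕ.+-cancelˡ-≡ 17 _ _ (trans (cong (_+ axis (flip i y)) (sym p)) (axis-flip i y))

mostPerfect⇒balanced : ∀ s → MostPerfect s → Balanced (onCube s)
mostPerfect⇒balanced s mp = balanced-from-diagonal (mostPerfect⇒balances s mp)
  -- Flipping coordinates `1F` and `3F` leads from cell (0, 0) to cell (1, 1), and their antipodes
  -- are (2, 2) and (3, 3): together, the main diagonal.
  (to gray-↔ (0F , 0F)) {1F} {3F}
  (trans (solve 4 (λ a b c d → (a :+ c) :+ (b :+ d) := a :+ (b :+ (c :+ (d :+ con 0)))) refl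
            (entry s (0F , 0F)) (entry s (1F , 1F)) (entry s (2F , 2F)) (entry s (3F , 3F)))
         (diagonals mp 0F))
  where open +-*-Solver

-- Cells two steps apart on a diagonal, broken or not, are antipodal, so every diagonal consists of
-- two pairs of sum 17.
balanced⇒mostPerfect : ∀ s → Balanced (onCube s) → MostPerfect s
balanced⇒mostPerfect s b = record
  { rows          = λ { 0F → row₀ 0F ; 1F → row₀ 1F ; 2F → row₀ 2F ; 3F → row₀ 3F }
  ; columns       = λ { 0F → column₀ 0F ; 1F → column₀ 1F ; 2F → column₀ 2F ; 3F → column₀ 3F }
  ; subsquares    = λ i j → trans (rotate (entry s (i , j)) _ _ _)
      (trans (cong (total (entry s)) (toWitness {a? = subsquare?} _ i j))
             (squares b (to gray-↔ (i , j)) (step-≢ j i)))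
  ; diagonals     = λ
    { 0F → axes (0F , 0F) (1F , 1F) ; 1F → axes (0F , 1F) (1F , 2F)
    ; 2F → axes (0F , 2F) (1F , 3F) ; 3F → axes (0F , 3F) (1F , 0F) }
  ; antidiagonals = λ
    { 0F → axes (0F , 3F) (1F , 2F) ; 1F → axes (0F , 0F) (1F , 3F)
    ; 2F → axes (0F , 1F) (1F , 0F) ; 3F → axes (0F , 2F) (1F , 1F) }
  }
  where
  row₀ = λ i → squares b (to gray-↔ (i , 0F)) {3F} {2F} (λ ())
  column₀ = λ j → squares b (to gray-↔ (0F , j)) {1F} {0F} (λ ())

  -- The coordinates changed by the edges from (i , j) to (i , j ⊕ 1F) and to (i ⊕ 1F , j).
  stepʰ stepᵛ : Fin 4 → Fin 4
  stepʰ = lookup (3F ∷ 2F ∷ 3F ∷ 2F ∷ [])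
  stepᵛ = lookup (1F ∷ 0F ∷ 1F ∷ 0F ∷ [])

  step-≢ : ∀ j i → stepʰ j ≢ stepᵛ i
  step-≢ = toWitness {a? = Fin.all? λ j → Fin.all? λ i → ¬? (stepʰ j Fin.≟ stepᵛ i)} _

  cyclic : Fin 4 → Fin 4 → List Position
  cyclic i j = (i , j) ∷ (i , j ⊕ 1F) ∷ (i ⊕ 1F , j ⊕ 1F) ∷ (i ⊕ 1F , j) ∷ []

  subsquare? = Fin.all? λ i → Fin.all? λ j → List.≡-dec (≡-dec Fin._≟_ Fin._≟_)
    (cyclic i j) (List.map (from gray-↔) (square (to gray-↔ (i , j)) (stepʰ j) (stepᵛ i)))

  open +-*-Solver

  rotate : ∀ a b c d → a + b + c + d ≡ a + (b + (d + (c + 0)))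
  rotate = solve 4 (λ a b c d → a :+ b :+ c :+ d := a :+ (b :+ (d :+ (c :+ con 0)))) refl

  axes : ∀ p q → let p̄ = from gray-↔ (complement (to gray-↔ p))
                     q̄ = from gray-↔ (complement (to gray-↔ q))
                 in entry s p + (entry s q + (entry s p̄ + (entry s q̄ + 0))) ≡ 34
  axes p q = trans
    (solve 4 (λ a b c d → a :+ (b :+ (c :+ (d :+ con 0))) := (a :+ c) :+ (b :+ d)) refl
       (entry s p) (entry s q) _ _)
    (cong₂ _+_ (axis p) (axis q))
    where
    axis : ∀ p → entry s p + entry s (from gray-↔ (complement (to gray-↔ p))) ≡ 17
    axis p = trans (cong (λ r → entry s r + entry s (from gray-↔ (complement (to gray-↔ p))))
                         (sym (strictlyInverseʳ gray-↔ p)))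
                   (antipodes b (to gray-↔ p))

-- The orbit of the Khajuraho square

module _ {F G : Vec Bool 4 → ℕ} (F-balances : Balances F) (G-balances : Balances G) where

  -- A square at x carries agreement on x and its neighbours over to the neighbours of flip j x.
  balances-unique : ∀ x → F x ≡ G x → (∀ i → F (flip i x) ≡ G (flip i x)) → ∀ y → F y ≡ G y
  balances-unique x p q y = proj₁ (flip-induction Agree step {x} (p , q) y)
    where
    Agree : Vec Bool 4 → Set
    Agree x = F x ≡ G x × ∀ i → F (flip i x) ≡ G (flip i x)

    cancel : ∀ {a b c c′ d} → a + (b + (c + (d + 0))) ≡ a + (b + (c′ + (d + 0))) → c ≡ c′
    cancel {a} {b} {c} {c′} {d} =
      ℕ.+-cancelʳ-≡ (d + 0) c c′ ∘ ℕ.+-cancelˡ-≡ b _ _ ∘ ℕ.+-cancelˡ-≡ a _ _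

    step : ∀ j x → Agree x → Agree (flip j x)
    step j x (p , q) = q j , neighbour
      where
      neighbour : ∀ i → F (flip i (flip j x)) ≡ G (flip i (flip j x))
      neighbour i with j Fin.≟ i
      ... | yes refl = subst (λ y → F y ≡ G y) (sym (flip-involutive i x)) p
      ... | no j≢i   = cancel {F x} {F (flip j x)} {d = F (flip i x)}
        (trans (F-balances x j≢i) (trans (sym (G-balances x j≢i))
          (sym (cong₂ _+_ p (cong₂ _+_ (q j) (cong (λ k → G (flip i (flip j x)) + (k + 0)) (q i)))))))

-- The neighbours of the entry 16

IsNeighbourhood : (Fin 4 → ℕ) → Set
IsNeighbourhood b = (∀ i → 2 ≤ b i)
                  × (∀ i j → b i ≡ b j → i ≡ j)
                  × (∀ i j k → i ≢ j → b i + b j ≢ b k + 1)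

-- The neighbours of 16 in the Khajuraho square.
neighbours : Fin 4 → ℕ
neighbours = lookup (2 ∷ 9 ∷ 5 ∷ 3 ∷ [])

-- Both inclusions between the sets of values are kept: they supply a permutation and its inverse in
-- `matching`.
Matches : (Fin 4 → ℕ) → Set
Matches b = (∀ t → ∃[ i ] b i ≡ neighbours t) × (∀ i → ∃[ t ] b i ≡ neighbours t)

-- With c i = b i ∸ 1: 1, 2, 4, 8 are the only four distinct positive integers
-- with sum 15 none of which is the sum of two others.
isNeighbourhood⇒matches : ∀ b → (∀ i → b i < 18) → b 0F + b 1F + b 2F + b 3F ≡ 19 →
                          IsNeighbourhood b → Matches b
isNeighbourhood⇒matches b b<18 b-sum (p , q , r) =
  let (t→i , i→t) = toWitness {a? = all-checked?} _
                      (b<18 0F) (b<18 1F) (b<18 2F)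
                      (λ i → subst (2 ≤_) (b≗v i) (p i))
                      (λ i j e → q i j (trans (b≗v i) (trans e (sym (b≗v j)))))
                      (λ i j k i≢j e → r i j k i≢j
                        (trans (cong₂ _+_ (b≗v i) (b≗v j)) (trans e (cong (_+ 1) (sym (b≗v k))))))
  in (λ t → let (i , e) = t→i t in i , trans (b≗v i) e)
   , (λ i → let (t , e) = i→t i in t , trans (b≗v i) e)
  where
  -- The sum determines the fourth value, which leaves a search over triples. If truncation occurs
  -- the fourth value is 0 and fails the bound 2.
  values : ℕ → ℕ → ℕ → Fin 4 → ℕ
  values b₀ b₁ b₂ = lookup (b₀ ∷ b₁ ∷ b₂ ∷ 19 ∸ (b₀ + b₁ + b₂) ∷ [])

  b≗v : ∀ i → b i ≡ values (b 0F) (b 1F) (b 2F) i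
  b≗v 0F = refl
  b≗v 1F = refl
  b≗v 2F = refl
  b≗v 3F = trans (sym (ℕ.m+n∸m≡n (b 0F + b 1F + b 2F) (b 3F))) (cong (_∸ (b 0F + b 1F + b 2F)) b-sum)

  check? = λ b₀ b₁ b₂ → let b = values b₀ b₁ b₂ in
    Fin.all? (λ i → 2 ℕ.≤? b i) →-dec
    (Fin.all? (λ i → Fin.all? λ j → (b i ℕ.≟ b j) →-dec (i Fin.≟ j)) →-dec
    (Fin.all? (λ i → Fin.all? λ j → Fin.all? λ k →
       ¬? (i Fin.≟ j) →-dec ¬? (b i + b j ℕ.≟ b k + 1)) →-dec
    (Fin.all? (λ t → Fin.any? λ i → b i ℕ.≟ neighbours t) ×-dec
     Fin.all? (λ i → Fin.any? λ t → b i ℕ.≟ neighbours t))))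

  all-checked? =
    ℕ.allUpTo? (λ b₀ → ℕ.allUpTo? (λ b₁ → ℕ.allUpTo? (λ b₂ → check? b₀ b₁ b₂) 18) 18) 18

-- In a direction used by none of the three flips the coordinate is unchanged, which shows that two
-- vertices are not antipodal.
avoid : ∀ (i j k : Fin 4) → ∃[ l ] l ≢ i × l ≢ j × l ≢ k
avoid = toWitness {a? = Fin.all? λ i → Fin.all? λ j → Fin.all? λ k → Fin.any? λ l →
  ¬? (l Fin.≟ i) ×-dec ¬? (l Fin.≟ j) ×-dec ¬? (l Fin.≟ k)} _

module _ (F : Vec Bool 4 → ℕ) (F-injective : ∀ x y → F x ≡ F y → x ≡ y) (F≥1 : ∀ x → 1 ≤ F x)
         (F-balanced : Balanced F) (u : Vec Bool 4) (F-u : F u ≡ 16) where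
  private
    b : Fin 4 → ℕ
    b i = F (flip i u)

    complement-≢ : ∀ (x y : Vec Bool 4) l → lookup x l ≡ lookup y l → complement x ≢ y
    complement-≢ x y l p e = not-¬ refl (trans p
      (trans (cong (λ z → lookup z l) (sym e)) (lookup-map l not x)))

    opposite-square : ∀ {i j} → i ≢ j → b i + b j + F (flip j (flip i u)) ≡ 18
    opposite-square {i} {j} i≢j = ℕ.+-cancelˡ-≡ 16 _ _ (begin
      16 + (b i + b j + F (flip j (flip i u)))
        ≡⟨ solve 4 (λ a b c d → a :+ (b :+ d :+ c) := a :+ (b :+ (c :+ (d :+ con 0)))) refl
             16 (b i) (F (flip j (flip i u))) (b j) ⟩
      16 + (b i + (F (flip j (flip i u)) + (b j + 0)))
        ≡⟨ cong (_+ (b i + (F (flip j (flip i u)) + (b j + 0)))) F-u ⟨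
      total F (square u i j)
        ≡⟨ squares F-balanced u i≢j ⟩
      34 ∎)
      where
      open ≡-Reasoning
      open +-*-Solver

    -- All three conditions express that labels are distinct. The label 1 is taken by the antipode
    -- of `u`. The vertex opposite `u` in a square has label 18 - `b i` - `b j`, the antipode of
    -- `flip k u` has label 17 - `b k`, and these are different vertices.
    isNeighbourhood : IsNeighbourhood b
    isNeighbourhood =
        (λ i → ℕ.≤∧≢⇒< (F≥1 (flip i u)) λ 1≡bᵢ →
          let (l , l≢i , _) = avoid i i i in
          complement-≢ u (flip i u) l (sym (lookup-flip-≢ u l≢i))
            (F-injective _ _ (trans Fū≡1 1≡bᵢ)))
      , (λ i j e → flip-injective u (F-injective _ _ e))
      , (λ i j k i≢j e → let (l , l≢i , l≢j , l≢k) = avoid i j k in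
          complement-≢ (flip k u) (flip j (flip i u)) l
            (trans (lookup-flip-≢ u l≢k)
              (sym (trans (lookup-flip-≢ (flip i u) l≢j) (lookup-flip-≢ u l≢i))))
            (F-injective _ _ (ℕ.+-cancelˡ-≡ (b k + 1) _ _
              (trans (trans (cong (_+ F (complement (flip k u))) (ℕ.+-comm (b k) 1))
                            (cong suc (antipodes F-balanced (flip k u))))
                     (trans (sym (opposite-square i≢j)) (cong (_+ F (flip j (flip i u))) e))))))
      where
      Fū≡1 : F (complement u) ≡ 1
      Fū≡1 = ℕ.+-cancelˡ-≡ 16 _ 1 (trans (cong (_+ F (complement u)) (sym F-u)) (antipodes F-balanced u))

    -- Two squares at `u` and one antipodal pair contribute 18 + 18 + 17 = 53; the square at
    -- `flip 0F u` removes 34 of it and leaves the four neighbours.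
    sum-19 : b 0F + b 1F + b 2F + b 3F ≡ 19
    sum-19 = ℕ.+-cancelʳ-≡ 34 _ 19 (begin
      b 0F + b 1F + b 2F + b 3F + 34
        ≡⟨ cong (b 0F + b 1F + b 2F + b 3F +_) (squares F-balanced (flip 0F u) {1F} {2F} (λ ())) ⟨
      b 0F + b 1F + b 2F + b 3F + (b 0F + (p + (r + (q + 0))))
        ≡⟨ solve 7 (λ b₀ b₁ b₂ b₃ p q r →
             b₀ :+ b₁ :+ b₂ :+ b₃ :+ (b₀ :+ (p :+ (r :+ (q :+ con 0))))
               := (b₀ :+ b₁ :+ p) :+ (b₀ :+ b₂ :+ q) :+ (b₃ :+ r)) refl
             (b 0F) (b 1F) (b 2F) (b 3F) p q r ⟩
      (b 0F + b 1F + p) + (b 0F + b 2F + q) + (b 3F + r)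
        ≡⟨ cong₂ _+_ (cong₂ _+_ (opposite-square {0F} {1F} (λ ())) (opposite-square {0F} {2F} (λ ())))
             (trans (cong (λ x → b 3F + F x) (far u)) (antipodes F-balanced (flip 3F u))) ⟩
      53 ∎)
      where
      open ≡-Reasoning
      open +-*-Solver
      p = F (flip 1F (flip 0F u))
      q = F (flip 2F (flip 0F u))
      r = F (flip 2F (flip 1F (flip 0F u)))

      far : ∀ u → flip 2F (flip 1F (flip 0F u)) ≡ complement (flip 3F u)
      far u@(_ ∷ _ ∷ _ ∷ _ ∷ []) = sym (trans (complement-flip 3F u) (flip-involutive 3F _))

  matches : Matches b
  matches = isNeighbourhood⇒matches b
    (λ i → s≤s (subst (b i ≤_) (antipodes F-balanced (flip i u)) (ℕ.m≤m+n _ _)))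
    sum-19 isNeighbourhood

khajuraho-mostPerfect : MostPerfect khajuraho
khajuraho-mostPerfect = record
  { rows          = λ { 0F → refl ; 1F → refl ; 2F → refl ; 3F → refl }
  ; columns       = λ { 0F → refl ; 1F → refl ; 2F → refl ; 3F → refl }
  ; subsquares    = toWitness {a? = Fin.all? λ i → Fin.all? λ j →
                      k (i , j) + k (i , j ⊕ 1F) + k (i ⊕ 1F , j) + k (i ⊕ 1F , j ⊕ 1F) ℕ.≟ 34} _
  ; diagonals     = λ { 0F → refl ; 1F → refl ; 2F → refl ; 3F → refl }
  ; antidiagonals = λ { 0F → refl ; 1F → refl ; 2F → refl ; 3F → refl }
  }
  where k = entry khajuraho

khajuraho-balanced : Balanced (onCube khajuraho)
khajuraho-balanced = mostPerfect⇒balanced khajuraho khajuraho-mostPerfect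

open Action permutePositions using (_▷_; ▷-cong; InOrbit)

▷-mostPerfect : ∀ g s → MostPerfect s → MostPerfect (g ▷ s)
▷-mostPerfect g s mp = balanced⇒mostPerfect (g ▷ s)
  (balanced-resp-≗ (λ x → cong (entry s) (strictlyInverseʳ gray-↔ (from (proj₁ g) (from gray-↔ x))))
    (balanced-∘ (mostPerfect⇒balanced s mp)
      -- The action reads entries through `from`, so the labelling is composed with the conjugate of
      -- the inverse of `g`.
      (conjugate (C₄ □ C₄) (Q 4) gray (Group._⁻¹ (Aut (C₄ □ C₄)) g))))

mostPerfect-resp-≈ : ∀ s t → Setoid._≈_ arrangements s t → MostPerfect s → MostPerfect t
mostPerfect-resp-≈ s t s≈t mp = balanced⇒mostPerfect t
  (balanced-resp-≗ (s≈t ∘ from gray-↔) (mostPerfect⇒balanced s mp))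

neighbours-injective : ∀ t t′ → neighbours t ≡ neighbours t′ → t ≡ t′
neighbours-injective = toWitness {a? = Fin.all? λ t → Fin.all? λ t′ →
  (neighbours t ℕ.≟ neighbours t′) →-dec (t Fin.≟ t′)} _

matching : ∀ b → (∀ i j → b i ≡ b j → i ≡ j) → Matches b →
           Σ[ σ ∈ Fin 4 ↔ Fin 4 ] (∀ t → b (to σ t) ≡ neighbours t)
matching b b-injective (t→i , i→t) = mk↔ₛ′ (proj₁ ∘ t→i) (proj₁ ∘ i→t)
    (λ i → b-injective _ i (trans (proj₂ (t→i (proj₁ (i→t i)))) (sym (proj₂ (i→t i)))))
    (λ t → neighbours-injective _ t (trans (sym (proj₂ (i→t (proj₁ (t→i t))))) (proj₂ (t→i t))))
  , proj₂ ∘ t→i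

-- With `σ` given, the signs are chosen to send `w` to `u`; the two labellings then agree at `w` and
-- its neighbours, hence everywhere.
balanced-orbit : ∀ {F G} → Balanced F → Balanced G → ∀ {u w} → F u ≡ G w →
                 Σ[ σ ∈ Fin 4 ↔ Fin 4 ] (∀ t → F (flip (to σ t) u) ≡ G (flip t w)) →
                 ∃[ h ] (∀ x → F (signedPermute h x) ≡ G x)
balanced-orbit {F} {G} F-balanced G-balanced {u} {w} Fu≡Gw (σ , F∘σ≗G) =
  let (v , h-w) = signedPermute-transitive σ w u ; h = v , σ in
  h , balances-unique {F ∘ signedPermute h} {G}
    (squares (balanced-∘ {F} F-balanced (signedPermute-automorphism h))) (squares G-balanced)
    w (trans (cong F h-w) Fu≡Gw)
    λ t → trans (cong F (trans (signedPermute-flip h t w) (cong (flip (to σ t)) h-w))) (F∘σ≗G t)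

mostPerfect⇒balanced-orbit : ∀ s → MostPerfect s →
                             ∃[ h ] (∀ x → onCube s (signedPermute h x) ≡ onCube khajuraho x)
mostPerfect⇒balanced-orbit s mp =
  -- Cell (2, 0) holds 16 in the Khajuraho square, and `neighbours` lists the adjacent entries by
  -- direction of flip.
  balanced-orbit F-balanced khajuraho-balanced {u} {to gray-↔ (2F , 0F)} F-u
    (proj₁ σ , λ t → trans (proj₂ σ t) (neighbours-khajuraho t))
  where
  F : Vec Bool 4 → ℕ
  F = onCube s

  F-balanced : Balanced F
  F-balanced = mostPerfect⇒balanced s mp

  F-injective : ∀ x y → F x ≡ F y → x ≡ y
  F-injective x y = ↔-injective (↔-sym gray-↔) ∘ injective s _ _

  p-16 : ∃[ p ] entry s p ≡ 16
  p-16 = onto s 16 (s≤s z≤n) ℕ.≤-refl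

  u : Vec Bool 4
  u = to gray-↔ (proj₁ p-16)

  F-u : F u ≡ 16
  F-u = trans (cong (entry s) (strictlyInverseʳ gray-↔ (proj₁ p-16))) (proj₂ p-16)

  σ : Σ[ σ ∈ Fin 4 ↔ Fin 4 ] (∀ t → F (flip (to σ t) u) ≡ neighbours t)
  σ = matching (λ i → F (flip i u)) (λ i j e → flip-injective u (F-injective _ _ e))
        (matches F F-injective (λ x → proj₁ (range s (from gray-↔ x))) F-balanced u F-u)

  neighbours-khajuraho : ∀ t → neighbours t ≡ onCube khajuraho (flip t (to gray-↔ (2F , 0F)))
  neighbours-khajuraho = λ { 0F → refl ; 1F → refl ; 2F → refl ; 3F → refl }

-- From `s ∘ h = t` follows `s = t ∘ h⁻¹`, and composing with the inverse is how `h` acts on `t`.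
onCube-orbit⇒inOrbit : ∀ s t → ∃[ h ] (∀ x → onCube s (signedPermute h x) ≡ onCube t x) →
                       InOrbit t s
onCube-orbit⇒inOrbit s t (h , e) =
    conjugate (Q 4) (C₄ □ C₄) (graphIso-sym (C₄ □ C₄) (Q 4) gray) (signedPermute-automorphism h)
  , λ p → trans (cong (entry s) (sym (strictlyInverseʳ gray-↔ p)))
      (trans (cong (onCube s) (sym (strictlyInverseˡ (signedPermute-↔ h) (to gray-↔ p))))
        (e (from (signedPermute-↔ h) (to gray-↔ p))))

mostPerfect⇒inOrbit : ∀ s → MostPerfect s → InOrbit khajuraho s
mostPerfect⇒inOrbit s mp = onCube-orbit⇒inOrbit s khajuraho (mostPerfect⇒balanced-orbit s mp)

mostPerfect⇔inOrbit : ∀ s → MostPerfect s ⇔ InOrbit khajuraho s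
mostPerfect⇔inOrbit s = mk⇔ (mostPerfect⇒inOrbit s) λ (g , s≈gk) →
  mostPerfect-resp-≈ (g ▷ khajuraho) s (sym ∘ s≈gk) (▷-mostPerfect g khajuraho khajuraho-mostPerfect)

-- Freeness of the action and the number of squares

▷-free : ∀ s (g h : Group.Carrier (Aut (C₄ □ C₄))) →
         Setoid._≈_ arrangements (g ▷ s) (h ▷ s) → Group._≈_ (Aut (C₄ □ C₄)) g h
▷-free s (g , _) (h , _) p =
  Group.⁻¹-cong (Sym Position) {↔-sym g} {↔-sym h} λ q → injective s _ _ (p q)

-- The bijection is stated for an abstract proof of transitivity because unfolding
-- mostPerfect⇒inOrbit would rerun the finite searches behind it.
orbit-bijection : (∀ s → MostPerfect s → InOrbit khajuraho s) →
                  Inverse (Group.setoid (Aut (C₄ □ C₄))) mostPerfectSquares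
orbit-bijection inOrbit = record
  { to        = λ g → g ▷ khajuraho , ▷-mostPerfect g khajuraho khajuraho-mostPerfect
  ; from      = λ (s , mp) → proj₁ (inOrbit s mp)
  ; to-cong   = λ {g} {h} → ▷-congˡ g h
  ; from-cong = λ {(s , mp)} {(t , mp′)} s≈t →
      ▷-free khajuraho (proj₁ (inOrbit s mp)) (proj₁ (inOrbit t mp′)) λ p →
        trans (sym (proj₂ (inOrbit s mp) p)) (trans (s≈t p) (proj₂ (inOrbit t mp′) p))
  ; inverse   =
      (λ {(s , mp)} {g} g≈ p →
         trans (▷-congˡ g (proj₁ (inOrbit s mp)) g≈ p) (sym (proj₂ (inOrbit s mp) p)))
    , (λ {g} {(s , mp)} s≈ → ▷-free khajuraho (proj₁ (inOrbit s mp)) g λ p →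
         trans (sym (proj₂ (inOrbit s mp) p)) (s≈ p))
  }
  where
  ▷-congˡ : ∀ g h → Group._≈_ (Aut (C₄ □ C₄)) g h →
            Setoid._≈_ arrangements (g ▷ khajuraho) (h ▷ khajuraho)
  ▷-congˡ g h g≈h = ▷-cong {g} {h} {khajuraho} {khajuraho} g≈h λ _ → refl

order-AutTorus : Order (Aut (C₄ □ C₄)) (16 * 24)
order-AutTorus = ≅⇒Order (Aut (Q 4)) (Aut (C₄ □ C₄))
  (≅-sym (Aut (C₄ □ C₄)) (Aut (Q 4))
    (conjugate (C₄ □ C₄) (Q 4) gray , conjugate-isGroupIsomorphism (C₄ □ C₄) (Q 4) gray))
  (≅⇒Order (C₂ⁿ⋊Sₙ 4) (Aut (Q 4)) (C₂ⁿ⋊Sₙ≅AutQ 4)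
    (order-semidirect (C₂^ 4) (S 4) (permuteCoordinates 4) (λ _ _ _ _ → refl)
      (order-C₂^ 4) (order-S 4)))

theorem8 : Σ[ θ ∈ GraphIso (C₄ □ C₄) (Q 4) ]
    IsGroupIsomorphism (Aut (C₄ □ C₄)) (Aut (Q 4)) (conjugate (C₄ □ C₄) (Q 4) θ)
    × Aut (Q 4) ≅ W[B 4 ]
    × W[B 4 ] ≅ C₂ⁿ⋊Sₙ 4
    × Order (C₂^ 4) 16
    × Order (S 4) 24
    × Order (Aut (C₄ □ C₄)) (16 * 24)
    × HasCardinality mostPerfectSquares 384
    × (∀ s → MostPerfect s ⇔ Action.InOrbit permutePositions khajuraho s)
    × Action.FaithfulOn permutePositions MostPerfect
theorem8 = gray
  , conjugate-isGroupIsomorphism (C₄ □ C₄) (Q 4) gray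
  , ≅-trans (Aut (Q 4)) (C₂ⁿ⋊Sₙ 4) W[B 4 ]
      (≅-sym (C₂ⁿ⋊Sₙ 4) (Aut (Q 4)) (C₂ⁿ⋊Sₙ≅AutQ 4)) C₂ⁿ⋊Sₙ≅W[B 4 ]
  , ≅-sym (C₂ⁿ⋊Sₙ 4) W[B 4 ] C₂ⁿ⋊Sₙ≅W[B 4 ]
  , order-C₂^ 4
  , order-S 4
  , order-AutTorus
  , Compose.inverse order-AutTorus (orbit-bijection mostPerfect⇒inOrbit)
  , mostPerfect⇔inOrbit
  -- By freeness, fixing this single square already forces the identity.
  , λ g fixes → ▷-free khajuraho g (Group.ε (Aut (C₄ □ C₄))) (fixes khajuraho khajuraho-mostPerfect)
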